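{- Let $n,k,s$ be positive integers with $n>2^5 s\log_2(sk)$. Then the sequence $(f_1,\ldots,f_s)$ with $$f_i=(i-1)n^{k-1} + 4(s-1)^2 n^{k-2} + 2^{15}s^3 \log_2^3(sk)\, n^{k-3},\qquad i\in[s],$$ is satisfying; that is, whenever $\mathcal F_1,\ldots,\mathcal F_s\subset [n]^k$ satisfy $|\mathcal F_i|>f_i$ for every $i\in[s]$, there exist pairwise disjoint $F_1\in\mathcal F_1,\ldots,F_s\in\mathcal F_s$.
   Context: $[n]=\{1,\ldots,n\}$ and $[n]^k$ is the set of all $k$-tuples $(x_1,\ldots,x_k)$ with $x_j\in[n]$. A tuple $(x_1,\ldots,x_k)$ is identified with the $k$-element set $\{(1,x_1),\ldots,(k,x_k)\}\subset[k]\times[n]$; thus two tuples $x,y$ are disjoint iff $x_j\neq y_j$ for all $j\in[k]$. A sequence of reals $(f_1,\ldots,f_s)$ is satisfying if for all families $\mathcal F_1,\ldots,\mathcal F_s\subset[n]^k$ with $|\mathcal F_i|>f_i$ for each $i$, there exist pairwise disjoint $F_1\in\mathcal F_1,\ldots,F_s\in\mathcal F_s$ (a rainbow matching). -}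

module Defs where

open import Data.Nat using (ℕ; zero; suc; _+_; _*_; _∸_; _^_; _≤_; _<_)
open import Data.Fin using (Fin; toℕ)
open import Data.Vec using (Vec; lookup)
open import Data.List using (List; length)
open import Data.List.Relation.Unary.Unique.Propositional using (Unique)
open import Data.List.Membership.Propositional using (_∈_)
open import Data.Product using (Σ; _×_; ∃₂)
open import Relation.Binary.PropositionalEquality using (_≡_; _≢_)

Tuple : ℕ → ℕ → Set
Tuple n k = Vec (Fin n) k

record Family (n k : ℕ) : Set where
  field
    members : List (Tuple n k)
    unique  : Unique members
open Family public

card : ∀ {n k} → Family n k → ℕ
card F = length (members F)

Disjoint : ∀ {n k} → Tuple n k → Tuple n k → Set
Disjoint {k = k} x y = (j : Fin k) → lookup x j ≢ lookup y j

-- Write L = log₂(s·k) (a real ≥ 0). For naturals a, b with b ≥ 1: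
--   L < a / b   ⟺   (s·k)^b < 2^a.
-- "n > 2^5 · s · log₂(sk)"  ⟺  log₂(sk) < n / (32 s)  ⟺  (s·k)^(32 s) < 2^n   (s ≥ 1).
LargeN : ℕ → ℕ → ℕ → Set
LargeN n k s = (s * k) ^ (32 * s) < 2 ^ n

-- BoundExceeded n k s i m  expresses the real inequality  m > f_i  where
--   f_i = (i-1) n^(k-1) + 4 (s-1)^2 n^(k-2) + 2^15 s^3 L^3 n^(k-3),
-- with i-1 given as the natural number i₀ (i₀ = i - 1 ∈ {0,…,s-1}).
-- Multiplying by n² (n ≥ 1, k ≥ 1) this is
--   m n² > (i₀ n^(k+1) + 4(s-1)² n^k) + 2^15 s³ n^(k-1) L³,
-- and since L ≥ 0 and the rationals are dense, this is equivalent to the existence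
-- of a rational a/b (b ≥ 1) with L < a/b and
--   (i₀ n^(k+1) + 4(s-1)² n^k) b³ + 2^15 s³ n^(k-1) a³ < m n² b³.
BoundExceeded : ℕ → ℕ → ℕ → ℕ → ℕ → Set
BoundExceeded n k s i₀ m =
  ∃₂ λ (a b : ℕ) →
    (1 ≤ b) ×
    ((s * k) ^ b < 2 ^ a) ×
    ((i₀ * n ^ (k + 1) + 4 * (s ∸ 1) ^ 2 * n ^ k) * b ^ 3
       + 2 ^ 15 * s ^ 3 * n ^ (k ∸ 1) * a ^ 3
       < m * n ^ 2 * b ^ 3)

Satisfying : ℕ → ℕ → ℕ → Set
Satisfying n k s =
  (𝓕 : Fin s → Family n k) →
  ((i : Fin s) → BoundExceeded n k s (toℕ i) (card (𝓕 i))) →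
  Σ ((i : Fin s) → Tuple n k) λ F →
    ((i : Fin s) → F i ∈ members (𝓕 i)) ×
    ((i j : Fin s) → i ≢ j → Disjoint (F i) (F j))

{-# OPTIONS --safe #-}
-- Put ℓ = ⌊log₂ (s k)⌋ and R = 32 s ℓ, and view a tuple as a k-subset of the k × n grid.
--
-- Spread approximation.  A set T maximising deg T · R^∣T∣ in a family has a link that is R-spread.  Peeling off the
-- tuples through such sets while ∣T∣ ≤ 2 covers each family by the tuples through small "cores", up to R³ n^(k-3)
-- tuples.  Counting then shows that either the cores cannot all be met by 2 (s - 1) elements, or there are at least
-- i elements each of which can be completed to a core avoiding any 2 (s - 1) further elements.  A greedy choice
-- therefore gives pairwise disjoint cores, one for each family.
--
-- Spread lemma.  Colour the grid at random with s (ℓ + 1) colours, ℓ + 1 for each family.  Exposing one colour class W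
-- at a time, replace every set A of the family by the smallest A′ ∖ W with A′ ⊆ A ∪ W, ∣A′∣ ≤ ∣A∣.  Spreadness bounds
-- the mean of 4^∣A′ ∖ W∣ · 2^-∣A∣ by 1, so that each round at least halves the mean size.  After ℓ + 1 rounds
-- the expected sizes, summed over the families, are s k / 2^(ℓ+1) < 1; some colouring thus contains a member of
-- each link in the colours of its family, and these members are disjoint.
module Submission where

open import Defs
open import Data.Bool using (true; false; if_then_else_)
open import Data.Fin as Fin using (Fin; zero; suc; toℕ)
open import Data.Fin.Properties as Finₚ using (any?)
open import Data.Fin.Subset as Subset using (Subset; _⊆_; ∣_∣; ⁅_⁆; _∪_; _─_; ⋃)
open import Data.Fin.Subset.Properties as Subsetₚ using (_∈?_; _⊆?_)
open import Data.List as List using (List; []; _∷_; _++_; length; map; filter; allFin; cartesianProductWith)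
open import Data.List.Membership.Propositional using (_∈_; find; lose)
open import Data.List.Membership.Propositional.Properties
  using (∈-filter⁺; ∈-filter⁻; ∈-allFin; ∈-∃++; ∈-++⁻; ∈-++⁺ˡ; ∈-++⁺ʳ; ∈-cartesianProductWith⁺; ∈-map⁺; ∈-map⁻; ∈-lookup; ∈-tabulate⁺; ∈-tabulate⁻)
open import Data.List.Properties using (length-tabulate; map-tabulate; tabulate-lookup; length-map)
open import Data.List.Relation.Unary.All as All using (All; []; _∷_)
import Data.List.Relation.Unary.All.Properties as Allₚ
open import Data.List.Relation.Unary.AllPairs using ([]; _∷_)
open import Data.List.Relation.Unary.Any as Any using (Any; here; there)
open import Data.List.Relation.Unary.Unique.Propositional using (Unique)
import Data.List.Relation.Unary.Unique.Propositional.Properties as Uniqueₚ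
open import Data.Nat
open import Data.Nat.ListAction using (sum)
open import Data.Nat.Properties
open import Data.List.Extrema ≤-totalOrder using (argmin; argmax; argmin-all; f[argmin]≤f[xs]; f[xs]≤f[argmax])
open import Data.Nat.Tactic.RingSolver using (solve-∀)
open import Data.Product using (∃; _×_; _,_; _,′_; proj₁; proj₂)
open import Data.Sum using (_⊎_; inj₁; inj₂)
open import Data.Vec as Vec using (Vec; []; _∷_; lookup; here; there)
open import Data.Vec.Properties
  using ([]=⇒lookup; lookup⇒[]=; lookup-map; lookup∘tabulate; lookup-++ˡ; lookup-++ʳ)
open import Function using (_∘_; id; case_of_)
open import Relation.Binary.PropositionalEquality
open import Relation.Nullary using (Dec; yes; no; does; ¬_; ¬?; contradiction; _×-dec_)
open import Relation.Nullary.Decidable using (decidable-stable)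
open import Relation.Unary using (Decidable)

private variable
  A B : Set
  h k m n N s : ℕ

+-swap : ∀ a b c → a + (b + c) ≡ b + (a + c)
+-swap = solve-∀

-- Finite sums

∑ : List A → (A → ℕ) → ℕ
∑ xs f = sum (map f xs)

∑-mono : ∀ (xs : List A) {f g} → (∀ {x} → x ∈ xs → f x ≤ g x) → ∑ xs f ≤ ∑ xs g
∑-mono []       f≤g = z≤n
∑-mono (x ∷ xs) f≤g = +-mono-≤ (f≤g (here refl)) (∑-mono xs (f≤g ∘ there))

∑-cong : ∀ (xs : List A) {f g} → (∀ x → f x ≡ g x) → ∑ xs f ≡ ∑ xs g
∑-cong []       f≡g = refl
∑-cong (x ∷ xs) f≡g = cong₂ _+_ (f≡g x) (∑-cong xs f≡g)

∑-distrib-+ : ∀ (xs : List A) f g → ∑ xs (λ x → f x + g x) ≡ ∑ xs f + ∑ xs g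
∑-distrib-+ []       f g = refl
∑-distrib-+ (x ∷ xs) f g = trans (cong (f x + g x +_) (∑-distrib-+ xs f g)) (swap-middle (f x) (g x) (∑ xs f) (∑ xs g))
  where
  swap-middle : ∀ a b c d → a + b + (c + d) ≡ a + c + (b + d)
  swap-middle = solve-∀

∑-distribˡ-* : ∀ (xs : List A) c f → ∑ xs (λ x → c * f x) ≡ c * ∑ xs f
∑-distribˡ-* []       c f = sym (*-zeroʳ c)
∑-distribˡ-* (x ∷ xs) c f = trans (cong (c * f x +_) (∑-distribˡ-* xs c f)) (sym (*-distribˡ-+ c (f x) _))

∑-distribʳ-* : ∀ (xs : List A) f c → ∑ xs (λ x → f x * c) ≡ ∑ xs f * c
∑-distribʳ-* []       f c = refl
∑-distribʳ-* (x ∷ xs) f c = trans (cong (f x * c +_) (∑-distribʳ-* xs f c)) (sym (*-distribʳ-+ c (f x) _))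

∑-const : ∀ (xs : List A) c → ∑ xs (λ _ → c) ≡ length xs * c
∑-const []       c = refl
∑-const (x ∷ xs) c = cong (c +_) (∑-const xs c)

∑-≤-const : ∀ (xs : List A) {f} c → (∀ {x} → x ∈ xs → f x ≤ c) → ∑ xs f ≤ length xs * c
∑-≤-const xs c f≤c = ≤-trans (∑-mono xs f≤c) (≤-reflexive (∑-const xs c))

∑-swap : ∀ (xs : List A) (ys : List B) (f : A → B → ℕ) →
         ∑ xs (λ x → ∑ ys (f x)) ≡ ∑ ys (λ y → ∑ xs (λ x → f x y))
∑-swap []       ys f = sym (trans (∑-const ys 0) (*-zeroʳ (length ys)))
∑-swap (x ∷ xs) ys f = trans (cong (∑ ys (f x) +_) (∑-swap xs ys f))
                             (sym (∑-distrib-+ ys (f x) (λ y → ∑ xs (λ x → f x y))))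

∑-∈ : ∀ {xs : List A} {x} f → x ∈ xs → f x ≤ ∑ xs f
∑-∈ f (here refl)      = m≤m+n _ _
∑-∈ f (there {x = y} x∈xs) = ≤-trans (∑-∈ f x∈xs) (m≤n+m _ (f y))

∑-++ : ∀ (xs ys : List A) f → ∑ (xs ++ ys) f ≡ ∑ xs f + ∑ ys f
∑-++ []       ys f = refl
∑-++ (x ∷ xs) ys f = trans (cong (f x +_) (∑-++ xs ys f)) (sym (+-assoc (f x) _ _))

∑-map : ∀ (g : A → B) (xs : List A) f → ∑ (map g xs) f ≡ ∑ xs (f ∘ g)
∑-map g []       f = refl
∑-map g (x ∷ xs) f = cong (f (g x) +_) (∑-map g xs f)

∑-cartesianProductWith : ∀ {C : Set} (g : A → B → C) xs ys f →
  ∑ (cartesianProductWith g xs ys) f ≡ ∑ xs (λ x → ∑ ys (λ y → f (g x y)))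
∑-cartesianProductWith g []       ys f = refl
∑-cartesianProductWith g (x ∷ xs) ys f =
  trans (∑-++ (map (g x) ys) _ f) (cong₂ _+_ (∑-map (g x) ys f) (∑-cartesianProductWith g xs ys f))

∑-lookup : ∀ (xs : List A) f → ∑ (allFin (length xs)) (f ∘ List.lookup xs) ≡ ∑ xs f
∑-lookup xs f = cong sum (trans (map-tabulate id (f ∘ List.lookup xs))
                         (trans (sym (map-tabulate (List.lookup xs) f)) (cong (map f) (tabulate-lookup xs))))

-- The values of f outside ys may be dropped, since f vanishes there.
∑-unique-⊆ : ∀ {xs ys : List A} f → Unique xs → (∀ {x} → x ∈ xs → 0 < f x → x ∈ ys) → ∑ xs f ≤ ∑ ys f
∑-unique-⊆ {xs = []}     f _ _ = z≤n
∑-unique-⊆ {xs = x ∷ xs} {ys} f (x∉xs ∷ uniq) xs⊆ys with f x in fx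
... | zero  = ∑-unique-⊆ f uniq (xs⊆ys ∘ there)
... | suc c with ys₁ , ys₂ , refl ← ∈-∃++ (xs⊆ys (here refl) (subst (0 <_) (sym fx) z<s)) = begin
  suc c + ∑ xs f               ≡⟨ cong (_+ ∑ xs f) (sym fx) ⟩
  f x + ∑ xs f                 ≤⟨ +-monoʳ-≤ (f x) (∑-unique-⊆ f uniq rest) ⟩
  f x + ∑ (ys₁ ++ ys₂) f       ≡⟨ cong (f x +_) (∑-++ ys₁ ys₂ f) ⟩
  f x + (∑ ys₁ f + ∑ ys₂ f)    ≡⟨ +-swap (f x) (∑ ys₁ f) (∑ ys₂ f) ⟩
  ∑ ys₁ f + (f x + ∑ ys₂ f)    ≡⟨ sym (∑-++ ys₁ (x ∷ ys₂) f) ⟩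
  ∑ (ys₁ ++ x ∷ ys₂) f         ∎
  where
  open ≤-Reasoning
  rest : ∀ {z} → z ∈ xs → 0 < f z → z ∈ ys₁ ++ ys₂
  rest z∈xs 0<fz with ∈-++⁻ ys₁ (xs⊆ys (there z∈xs) 0<fz)
  ... | inj₁ z∈ys₁         = ∈-++⁺ˡ z∈ys₁
  ... | inj₂ (there z∈ys₂) = ∈-++⁺ʳ ys₁ z∈ys₂
  ... | inj₂ (here refl)   = contradiction refl (All.lookup x∉xs z∈xs)

-- First-moment principle: it later picks a colouring that is bad for no family.
∑<length⇒∃zero : ∀ (xs : List A) f → ∑ xs f < length xs → ∃ λ x → f x ≡ 0
∑<length⇒∃zero (x ∷ xs) f ∑<len with f x in fx
... | zero  = x , fx
... | suc c = ∑<length⇒∃zero xs f (≤-trans (s≤s (m≤n+m _ c)) (s≤s⁻¹ ∑<len))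

ind : Dec A → ℕ
ind (yes _) = 1
ind (no _)  = 0

ind-yes : (p? : Dec A) → A → ind p? ≡ 1
ind-yes (yes _) _ = refl
ind-yes (no ¬p) p = contradiction p ¬p

ind-no : (p? : Dec A) → ¬ A → ind p? ≡ 0
ind-no (yes p) ¬p = contradiction p ¬p
ind-no (no _)  _  = refl

ind≤1 : (p? : Dec A) → ind p? ≤ 1
ind≤1 (yes _) = ≤-refl
ind≤1 (no _)  = z≤n

ind>0 : (p? : Dec A) → 0 < ind p? → A
ind>0 (yes p) _ = p

ind-mono : (a? : Dec A) (b? : Dec B) → (A → B) → ind a? ≤ ind b?
ind-mono (no _)  _  _   = z≤n
ind-mono (yes a) b? a⇒b = ≤-reflexive (sym (ind-yes b? (a⇒b a)))

ind-*-≤ : ∀ {c} (p? : Dec A) d → (A → d ≤ c) → ind p? * d ≤ c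
ind-*-≤ (yes p) d d≤c = ≤-trans (≤-reflexive (+-identityʳ d)) (d≤c p)
ind-*-≤ (no _)  d d≤c = z≤n

length-filter≡∑ : ∀ {P : A → Set} (P? : Decidable P) xs → length (filter P? xs) ≡ ∑ xs (ind ∘ P?)
length-filter≡∑ P? []       = refl
length-filter≡∑ P? (x ∷ xs) with P? x
... | yes _ = cong suc (length-filter≡∑ P? xs)
... | no _  = length-filter≡∑ P? xs

∑-partition : ∀ {P : A → Set} (P? : Decidable P) xs f → ∑ xs f ≡ ∑ (filter P? xs) f + ∑ (filter (¬? ∘ P?) xs) f
∑-partition P? []       f = refl
∑-partition P? (x ∷ xs) f with P? x
... | yes _ = trans (cong (f x +_) (∑-partition P? xs f)) (sym (+-assoc (f x) _ _))
... | no _  = trans (cong (f x +_) (∑-partition P? xs f)) (+-swap (f x) (∑ (filter P? xs) f) (∑ (filter (¬? ∘ P?) xs) f))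

length≡∑1 : ∀ (xs : List A) → length xs ≡ ∑ xs (λ _ → 1)
length≡∑1 xs = sym (trans (∑-const xs 1) (*-identityʳ _))

length-partition : ∀ {P : A → Set} (P? : Decidable P) xs → length xs ≡ length (filter P? xs) + length (filter (¬? ∘ P?) xs)
length-partition P? xs = trans (length≡∑1 xs) (trans (∑-partition P? xs (λ _ → 1))
  (sym (cong₂ _+_ (length≡∑1 (filter P? xs)) (length≡∑1 (filter (¬? ∘ P?) xs)))))

∑-filter-≤ : ∀ {P : A → Set} (P? : Decidable P) xs f → ∑ (filter P? xs) f ≤ ∑ xs f
∑-filter-≤ P? xs f = ≤-trans (m≤m+n _ _) (≤-reflexive (sym (∑-partition P? xs f)))

allVecs : List A → ∀ n → List (Vec A n)
allVecs xs zero    = [] ∷ []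
allVecs xs (suc n) = cartesianProductWith _∷_ xs (allVecs xs n)

∑-allVecs-suc : ∀ (xs : List A) n f → ∑ (allVecs xs (suc n)) f ≡ ∑ xs (λ x → ∑ (allVecs xs n) (λ v → f (x ∷ v)))
∑-allVecs-suc xs n f = ∑-cartesianProductWith _∷_ xs (allVecs xs n) f

∈-allVecs : ∀ {xs : List A} → (∀ x → x ∈ xs) → (v : Vec A n) → v ∈ allVecs xs n
∈-allVecs all []      = here refl
∈-allVecs all (x ∷ v) = ∈-cartesianProductWith⁺ _∷_ (all x) (∈-allVecs all v)

length-allVecs : ∀ (xs : List A) n → length (allVecs xs n) ≡ length xs ^ n
length-allVecs xs zero    = refl
length-allVecs xs (suc n) = begin
  length (allVecs xs (suc n))                 ≡⟨ length≡∑1 (allVecs xs (suc n)) ⟩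
  ∑ (allVecs xs (suc n)) (λ _ → 1)            ≡⟨ ∑-allVecs-suc xs n _ ⟩
  ∑ xs (λ _ → ∑ (allVecs xs n) (λ _ → 1))     ≡⟨ ∑-const xs _ ⟩
  length xs * ∑ (allVecs xs n) (λ _ → 1)      ≡⟨ cong (length xs *_) (sym (length≡∑1 (allVecs xs n))) ⟩
  length xs * length (allVecs xs n)           ≡⟨ cong (length xs *_) (length-allVecs xs n) ⟩
  length xs * length xs ^ n                   ∎
  where open ≡-Reasoning

allSubsets : ∀ n → List (Subset n)
allSubsets = allVecs (true ∷ false ∷ [])

∈-allSubsets : (T : Subset n) → T ∈ allSubsets n
∈-allSubsets = ∈-allVecs λ { true → here refl ; false → there (here refl) }

^-distribʳ-* : ∀ e a b → (a * b) ^ e ≡ a ^ e * b ^ e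
^-distribʳ-* zero    a b = refl
^-distribʳ-* (suc e) a b = trans (cong (a * b *_) (^-distribʳ-* e a b)) (regroup a b (a ^ e) (b ^ e))
  where
  regroup : ∀ a b c d → a * b * (c * d) ≡ a * c * (b * d)
  regroup = solve-∀

-- Subsets and colourings

∣p∪q∣≤∣p∣+∣q∣ : ∀ (p q : Subset N) → ∣ p ∪ q ∣ ≤ ∣ p ∣ + ∣ q ∣
∣p∪q∣≤∣p∣+∣q∣ []          []          = z≤n
∣p∪q∣≤∣p∣+∣q∣ (false ∷ p) (false ∷ q) = ∣p∪q∣≤∣p∣+∣q∣ p q
∣p∪q∣≤∣p∣+∣q∣ (false ∷ p) (true ∷ q)  = ≤-trans (s≤s (∣p∪q∣≤∣p∣+∣q∣ p q)) (≤-reflexive (sym (+-suc ∣ p ∣ _)))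
∣p∪q∣≤∣p∣+∣q∣ (true ∷ p)  (false ∷ q) = s≤s (∣p∪q∣≤∣p∣+∣q∣ p q)
∣p∪q∣≤∣p∣+∣q∣ (true ∷ p)  (true ∷ q)  = s≤s (≤-trans (∣p∪q∣≤∣p∣+∣q∣ p q) (+-monoʳ-≤ ∣ p ∣ (n≤1+n _)))

disjoint⇒∣p∣+∣q∣≤∣p∪q∣ : ∀ (p q : Subset N) → (∀ {e} → e Subset.∈ p → e Subset.∉ q) → ∣ p ∣ + ∣ q ∣ ≤ ∣ p ∪ q ∣
disjoint⇒∣p∣+∣q∣≤∣p∪q∣ []          []          _ = z≤n
disjoint⇒∣p∣+∣q∣≤∣p∪q∣ (false ∷ p) (false ∷ q) d = disjoint⇒∣p∣+∣q∣≤∣p∪q∣ p q λ e∈p e∈q → d (there e∈p) (there e∈q)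
disjoint⇒∣p∣+∣q∣≤∣p∪q∣ (false ∷ p) (true ∷ q)  d =
  ≤-trans (≤-reflexive (+-suc ∣ p ∣ _)) (s≤s (disjoint⇒∣p∣+∣q∣≤∣p∪q∣ p q λ e∈p e∈q → d (there e∈p) (there e∈q)))
disjoint⇒∣p∣+∣q∣≤∣p∪q∣ (true ∷ p)  (false ∷ q) d = s≤s (disjoint⇒∣p∣+∣q∣≤∣p∪q∣ p q λ e∈p e∈q → d (there e∈p) (there e∈q))
disjoint⇒∣p∣+∣q∣≤∣p∪q∣ (true ∷ p)  (true ∷ q)  d = contradiction here (d here)

x∈p─q⇒x∉q : ∀ (p q : Subset N) {e} → e Subset.∈ p ─ q → e Subset.∉ q
x∈p─q⇒x∉q (_ ∷ p) (true ∷ q)  (there e∈) (there e∈q) = x∈p─q⇒x∉q p q e∈ e∈q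
x∈p─q⇒x∉q (_ ∷ p) (false ∷ q) (there e∈) (there e∈q) = x∈p─q⇒x∉q p q e∈ e∈q

p⊆q∧∣q∣≤∣p∣⇒q⊆p : ∀ {p q : Subset N} → p ⊆ q → ∣ q ∣ ≤ ∣ p ∣ → q ⊆ p
p⊆q∧∣q∣≤∣p∣⇒q⊆p {p = p} p⊆q ∣q∣≤∣p∣ {e} e∈q with e ∈? p
... | yes e∈p = e∈p
... | no  e∉p = contradiction ∣q∣≤∣p∣ (<⇒≱ (Subsetₚ.p⊂q⇒∣p∣<∣q∣ (p⊆q , e , e∈q , e∉p)))

∑-subsets≤2^ : ∀ (S : Subset N) → ∑ (allSubsets N) (λ T → ind (T ⊆? S)) ≤ 2 ^ ∣ S ∣
∑-subsets≤2^ []                = ≤-refl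
∑-subsets≤2^ {suc N} (b ∷ S) = begin
  ∑ (allSubsets (suc N)) (λ T → ind (T ⊆? (b ∷ S)))
    ≡⟨ ∑-allVecs-suc _ N _ ⟩
  ∑ (true ∷ false ∷ []) (λ a → ∑ (allSubsets N) (λ T → ind ((a ∷ T) ⊆? (b ∷ S))))
    ≡⟨ cong (∑ (allSubsets N) (λ T → ind ((true ∷ T) ⊆? (b ∷ S))) +_) (+-identityʳ _) ⟩
  ∑ (allSubsets N) (λ T → ind ((true ∷ T) ⊆? (b ∷ S))) + ∑ (allSubsets N) (λ T → ind ((false ∷ T) ⊆? (b ∷ S)))
    ≤⟨ +-mono-≤ (in-bound b) (tail-bound _ b) ⟩
  in-value b + 2 ^ ∣ S ∣
    ≡⟨ total b ⟩
  2 ^ ∣ b ∷ S ∣ ∎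
  where
  open ≤-Reasoning
  in-value : _ → ℕ
  in-value true  = 2 ^ ∣ S ∣
  in-value false = 0
  tail-bound : ∀ a b → ∑ (allSubsets N) (λ T → ind ((a ∷ T) ⊆? (b ∷ S))) ≤ 2 ^ ∣ S ∣
  tail-bound a b = ≤-trans (∑-mono (allSubsets N) λ {T} _ → ind-mono ((a ∷ T) ⊆? (b ∷ S)) (T ⊆? S) Subsetₚ.drop-∷-⊆) (∑-subsets≤2^ S)
  in-bound : ∀ b → ∑ (allSubsets N) (λ T → ind ((true ∷ T) ⊆? (b ∷ S))) ≤ in-value b
  in-bound true  = tail-bound true true
  in-bound false = ≤-trans (∑-≤-const (allSubsets N) 0 λ {T} _ →
    ≤-reflexive (ind-no ((true ∷ T) ⊆? (false ∷ S)) λ T⊆S → case T⊆S here of λ ())) (≤-reflexive (*-zeroʳ (length (allSubsets N))))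
  total : ∀ b → in-value b + 2 ^ ∣ S ∣ ≡ 2 ^ ∣ b ∷ S ∣
  total true  = cong (2 ^ ∣ S ∣ +_) (sym (+-identityʳ _))
  total false = refl

Colouring : ℕ → ℕ → Set
Colouring m N = Vec (Fin m) N

allColourings : ∀ m N → List (Colouring m N)
allColourings m = allVecs (allFin m)

class : Fin m → Colouring m N → Subset N
class c = Vec.map λ d → does (d Fin.≟ c)

∈-class⁺ : ∀ {c : Fin m} {χ : Colouring m N} {e} → lookup χ e ≡ c → e Subset.∈ class c χ
∈-class⁺ {c = c} {χ} {e} χe≡c = lookup⇒[]= e _ (trans (lookup-map e _ χ) (helper (lookup χ e) χe≡c))
  where
  helper : ∀ d → d ≡ c → does (d Fin.≟ c) ≡ true
  helper d d≡c with d Fin.≟ c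
  ... | yes _  = refl
  ... | no d≢c = contradiction d≡c d≢c

∈-class⁻ : ∀ {c : Fin m} {χ : Colouring m N} {e} → e Subset.∈ class c χ → lookup χ e ≡ c
∈-class⁻ {c = c} {χ} {e} e∈ = helper (lookup χ e) (trans (sym (lookup-map e _ χ)) ([]=⇒lookup e∈))
  where
  helper : ∀ d → does (d Fin.≟ c) ≡ true → d ≡ c
  helper d eq with yes d≡c ← d Fin.≟ c = d≡c

-- The switching operation of the spread lemma: painting a fragment `T` with the colour of the
-- current round makes the set it came from lie wholly in that colour class.
recolour : Subset N → Fin m → Colouring m N → Colouring m N
recolour T c χ = Vec.zipWith (λ b d → if b then c else d) T χ

lookup-recolour-∈ : ∀ {T : Subset N} {c : Fin m} χ {e} → e Subset.∈ T → lookup (recolour T c χ) e ≡ c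
lookup-recolour-∈ (_ ∷ χ) here       = refl
lookup-recolour-∈ (_ ∷ χ) (there e∈) = lookup-recolour-∈ χ e∈

lookup-recolour-∉ : ∀ {T : Subset N} {c : Fin m} χ e → e Subset.∉ T → lookup (recolour T c χ) e ≡ lookup χ e
lookup-recolour-∉ {T = true ∷ T}  (_ ∷ χ) zero    e∉ = contradiction here e∉
lookup-recolour-∉ {T = false ∷ T} (_ ∷ χ) zero    e∉ = refl
lookup-recolour-∉ {T = _ ∷ T}     (_ ∷ χ) (suc e) e∉ = lookup-recolour-∉ χ e (e∉ ∘ there)

-- Every colouring has at most m ^ ∣ T ∣ preimages under recolouring T.
∑-recolour : ∀ (T : Subset N) (c : Fin m) g →
  ∑ (allColourings m N) (g ∘ recolour T c) ≤ m ^ ∣ T ∣ * ∑ (allColourings m N) g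
∑-recolour []          c g = ≤-reflexive (sym (+-identityʳ _))
∑-recolour {suc N} {m} (true ∷ T) c g = begin
  ∑ (allColourings m (suc N)) (g ∘ recolour (true ∷ T) c)
    ≡⟨ ∑-allVecs-suc (allFin m) N _ ⟩
  ∑ (allFin m) (λ _ → ∑ (allColourings m N) (λ χ → g (c ∷ recolour T c χ)))
    ≡⟨ ∑-const (allFin m) _ ⟩
  length (allFin m) * ∑ (allColourings m N) (λ χ → g (c ∷ recolour T c χ))
    ≡⟨ cong (_* ∑ (allColourings m N) (λ χ → g (c ∷ recolour T c χ))) (length-tabulate {n = m} id) ⟩
  m * ∑ (allColourings m N) (λ χ → g (c ∷ recolour T c χ))
    ≤⟨ *-monoʳ-≤ m (∑-recolour T c (g ∘ (c ∷_))) ⟩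
  m * (m ^ ∣ T ∣ * ∑ (allColourings m N) (g ∘ (c ∷_)))
    ≡⟨ sym (*-assoc m (m ^ ∣ T ∣) _) ⟩
  m * m ^ ∣ T ∣ * ∑ (allColourings m N) (g ∘ (c ∷_))
    ≤⟨ *-monoʳ-≤ (m * m ^ ∣ T ∣) (∑-∈ (λ d → ∑ (allColourings m N) (g ∘ (d ∷_))) (∈-allFin c)) ⟩
  m * m ^ ∣ T ∣ * ∑ (allFin m) (λ d → ∑ (allColourings m N) (g ∘ (d ∷_)))
    ≡⟨ cong (m * m ^ ∣ T ∣ *_) (sym (∑-allVecs-suc (allFin m) N g)) ⟩
  m ^ ∣ true ∷ T ∣ * ∑ (allColourings m (suc N)) g ∎
  where open ≤-Reasoning
∑-recolour {suc N} {m} (false ∷ T) c g = begin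
  ∑ (allColourings m (suc N)) (g ∘ recolour (false ∷ T) c)
    ≡⟨ ∑-allVecs-suc (allFin m) N _ ⟩
  ∑ (allFin m) (λ d → ∑ (allColourings m N) (λ χ → g (d ∷ recolour T c χ)))
    ≤⟨ ∑-mono (allFin m) (λ {d} _ → ∑-recolour T c (g ∘ (d ∷_))) ⟩
  ∑ (allFin m) (λ d → m ^ ∣ T ∣ * ∑ (allColourings m N) (g ∘ (d ∷_)))
    ≡⟨ ∑-distribˡ-* (allFin m) (m ^ ∣ T ∣) _ ⟩
  m ^ ∣ T ∣ * ∑ (allFin m) (λ d → ∑ (allColourings m N) (g ∘ (d ∷_)))
    ≡⟨ cong (m ^ ∣ T ∣ *_) (sym (∑-allVecs-suc (allFin m) N g)) ⟩
  m ^ ∣ T ∣ * ∑ (allColourings m (suc N)) g ∎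
  where open ≤-Reasoning

-- Spread lemma: one round of exposure

infix 8 _‼_
_‼_ : Vec (Subset N) h → Fin h → Subset N
_‼_ = lookup

-- Take `z` a smallest set of the family inside `W` and let `q` share the mass 2^k equally among the
-- subsets of `A ‼ z`. The choice depends on `A` and `W` alone, so `q` bounds how many fragments `T`
-- can lead to the same class `W` by recolouring.
smallest-weight : ∀ k (W : Subset N) (A : Vec (Subset N) h) → (∀ x → ∣ A ‼ x ∣ ≤ k) →
  ∃ λ (q : Subset N → ℕ) → ∑ (allSubsets N) q ≤ 2 ^ k ×
    (∀ y → A ‼ y ⊆ W → ∃ λ z → (A ‼ z ⊆ W) × (∣ A ‼ z ∣ ≤ ∣ A ‼ y ∣) ×
      (∀ T → T ⊆ A ‼ z → q T ≡ 2 ^ (k ∸ ∣ A ‼ z ∣)))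
smallest-weight {N} {h} k W A ∣A∣≤k with filter (λ y → A ‼ y ⊆? W) (allFin h) in eq
-- With no set inside `W` the zero weight serves, and the second claim is vacuous.
... | [] = (λ _ → 0) , ≤-trans (∑-≤-const (allSubsets N) 0 λ _ → z≤n) (≤-trans (≤-reflexive (*-zeroʳ (length (allSubsets N)))) z≤n)
         , λ y Ay⊆W → contradiction (subst (y ∈_) eq (∈-filter⁺ (λ y → A ‼ y ⊆? W) (∈-allFin y) Ay⊆W)) λ ()
... | z₀ ∷ zs = (λ T → ind (T ⊆? (A ‼ z)) * 2 ^ (k ∸ ∣ A ‼ z ∣)) , total
              , λ y Ay⊆W → z , z-admissible , minimal y Ay⊆W , λ T T⊆ → trans (cong (_* 2 ^ (k ∸ ∣ A ‼ z ∣)) (ind-yes (T ⊆? (A ‼ z)) T⊆)) (*-identityˡ _)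
  where
  size : Fin h → ℕ
  size y = ∣ A ‼ y ∣
  z = argmin size z₀ (z₀ ∷ zs)
  inside-W : ∀ {y} → y ∈ z₀ ∷ zs → A ‼ y ⊆ W
  inside-W y∈ = proj₂ (∈-filter⁻ (λ y → A ‼ y ⊆? W) {xs = allFin h} (subst (_ ∈_) (sym eq) y∈))
  z-admissible : A ‼ z ⊆ W
  z-admissible = argmin-all size {P = λ y → A ‼ y ⊆ W} (inside-W (here refl)) (All.tabulate inside-W)
  minimal : ∀ y → A ‼ y ⊆ W → size z ≤ size y
  minimal y Ay⊆W = All.lookup (f[argmin]≤f[xs] {f = size} z₀ (z₀ ∷ zs)) (subst (y ∈_) eq (∈-filter⁺ (λ y → A ‼ y ⊆? W) (∈-allFin y) Ay⊆W))
  total : ∑ (allSubsets N) (λ T → ind (T ⊆? (A ‼ z)) * 2 ^ (k ∸ ∣ A ‼ z ∣)) ≤ 2 ^ k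
  total = begin
    ∑ (allSubsets N) (λ T → ind (T ⊆? (A ‼ z)) * 2 ^ (k ∸ size z)) ≡⟨ ∑-distribʳ-* (allSubsets N) _ _ ⟩
    ∑ (allSubsets N) (λ T → ind (T ⊆? (A ‼ z))) * 2 ^ (k ∸ size z) ≤⟨ *-monoˡ-≤ _ (∑-subsets≤2^ (A ‼ z)) ⟩
    2 ^ size z * 2 ^ (k ∸ size z)                                ≡⟨ sym (^-distribˡ-+-* 2 (size z) (k ∸ size z)) ⟩
    2 ^ (size z + (k ∸ size z))                                  ≡⟨ cong (2 ^_) (m+[n∸m]≡n (∣A∣≤k z)) ⟩
    2 ^ k                                                        ∎
    where open ≤-Reasoning

module Fragment {N h : ℕ} (W : Subset N) (A : Vec (Subset N) h) where

  Admissible : Fin h → Fin h → Set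
  Admissible x y = (A ‼ y ⊆ A ‼ x ∪ W) × (∣ A ‼ y ∣ ≤ ∣ A ‼ x ∣)

  admissible? : ∀ x y → Dec (Admissible x y)
  admissible? x y = (A ‼ y ⊆? A ‼ x ∪ W) ×-dec (∣ A ‼ y ∣ ≤? ∣ A ‼ x ∣)

  best : Fin h → Fin h
  -- The default `x` is itself admissible, so the minimum is always over a nonempty set of
  -- candidates.
  best x = argmin (λ y → ∣ A ‼ y ─ W ∣) x (filter (admissible? x) (allFin h))

  best-admissible : ∀ x → Admissible x (best x)
  best-admissible x = argmin-all (λ y → ∣ A ‼ y ─ W ∣) {P = Admissible x} (Subsetₚ.p⊆p∪q W , ≤-refl)
    (All.tabulate λ y∈ → proj₂ (∈-filter⁻ (admissible? x) {xs = allFin h} y∈))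

  best-minimal : ∀ x y → Admissible x y → ∣ A ‼ best x ─ W ∣ ≤ ∣ A ‼ y ─ W ∣
  best-minimal x y adm = All.lookup (f[argmin]≤f[xs] {f = λ y → ∣ A ‼ y ─ W ∣} x _) (∈-filter⁺ (admissible? x) (∈-allFin y) adm)

-- Replaces each set A x by the smallest A y ─ W with A y ⊆ A x ∪ W; the side condition ∣ A y ∣ ≤ ∣ A x ∣
-- is what allows sets of different sizes in the counting below.
fragments : Subset N → Vec (Subset N) h → Vec (Subset N) h
fragments W A = Vec.tabulate λ x → A ‼ Fragment.best W A x ─ W

fragments-‼ : ∀ (W : Subset N) (A : Vec (Subset N) h) x → fragments W A ‼ x ≡ A ‼ Fragment.best W A x ─ W
fragments-‼ W A x = lookup∘tabulate _ x

-- Admissibility keeps the fragment inside `A ‼ x`: whatever the chosen set has outside `A ‼ x` lies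
-- in `W` and is removed.
∈-fragments⁻ : ∀ (W : Subset N) (A : Vec (Subset N) h) x {e} → e Subset.∈ fragments W A ‼ x → e Subset.∈ A ‼ x × e Subset.∉ W
∈-fragments⁻ W A x {e} e∈ =
  case Subsetₚ.x∈p∪q⁻ (A ‼ x) W (proj₁ (Fragment.best-admissible W A x) (Subsetₚ.p─q⊆p _ W e∈′)) of λ where
    (inj₁ e∈A) → e∈A , x∈p─q⇒x∉q _ W e∈′
    (inj₂ e∈W) → contradiction e∈W (x∈p─q⇒x∉q _ W e∈′)
  where
  e∈′ = subst (e Subset.∈_) (fragments-‼ W A x) e∈

1+d≤2^d : ∀ d → 1 + d ≤ 2 ^ d
1+d≤2^d zero    = ≤-refl
1+d≤2^d (suc d) = begin
  1 + (1 + d)         ≤⟨ +-mono-≤ (≤-trans (s≤s z≤n) (1+d≤2^d d)) (1+d≤2^d d) ⟩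
  2 ^ d + 2 ^ d       ≡⟨ cong (2 ^ d +_) (sym (+-identityʳ _)) ⟩
  2 ^ suc d           ∎
  where open ≤-Reasoning

-- 1 + (2t - l) ≤ 2^(2t - l), scaled by 2^k.
exponential-vs-linear : ∀ {k} t l → l ≤ k → 2 ^ k * (1 + 2 * t) ≤ 4 ^ t * 2 ^ (k ∸ l) + 2 ^ k * l
exponential-vs-linear {k} t l l≤k with l ≤? 2 * t
-- Here 1 + 2t ≤ l, so the linear term alone is large enough.
... | no l≰2t = ≤-trans (*-monoʳ-≤ (2 ^ k) (≰⇒> l≰2t)) (m≤n+m _ _)
... | yes l≤2t = begin
  2 ^ k * (1 + 2 * t)                  ≡⟨ cong (λ u → 2 ^ k * (1 + u)) (sym (m∸n+n≡m l≤2t)) ⟩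
  2 ^ k * ((1 + (2 * t ∸ l)) + l)      ≡⟨ *-distribˡ-+ (2 ^ k) _ l ⟩
  2 ^ k * (1 + (2 * t ∸ l)) + 2 ^ k * l ≤⟨ +-monoˡ-≤ _ (*-monoʳ-≤ (2 ^ k) (1+d≤2^d (2 * t ∸ l))) ⟩
  2 ^ k * 2 ^ (2 * t ∸ l) + 2 ^ k * l  ≡⟨ cong (_+ 2 ^ k * l) exponents ⟩
  4 ^ t * 2 ^ (k ∸ l) + 2 ^ k * l      ∎
  where
  open ≤-Reasoning
  rearrange : ∀ a b c → (a + b) + c ≡ (c + b) + a
  rearrange = solve-∀
  exponents : 2 ^ k * 2 ^ (2 * t ∸ l) ≡ 4 ^ t * 2 ^ (k ∸ l)
  exponents = begin-equality
    2 ^ k * 2 ^ (2 * t ∸ l)              ≡⟨ sym (^-distribˡ-+-* 2 k _) ⟩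
    2 ^ (k + (2 * t ∸ l))                ≡⟨ cong (λ u → 2 ^ (u + (2 * t ∸ l))) (sym (m∸n+n≡m l≤k)) ⟩
    2 ^ ((k ∸ l + l) + (2 * t ∸ l))      ≡⟨ cong (2 ^_) (rearrange (k ∸ l) l _) ⟩
    2 ^ ((2 * t ∸ l + l) + (k ∸ l))      ≡⟨ cong (λ u → 2 ^ (u + (k ∸ l))) (m∸n+n≡m l≤2t) ⟩
    2 ^ (2 * t + (k ∸ l))                ≡⟨ ^-distribˡ-+-* 2 (2 * t) _ ⟩
    2 ^ (2 * t) * 2 ^ (k ∸ l)            ≡⟨ cong (_* 2 ^ (k ∸ l)) (sym (^-*-assoc 2 2 t)) ⟩
    4 ^ t * 2 ^ (k ∸ l)                  ∎

degree : Vec (Subset N) h → Subset N → ℕ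
degree {h = h} B T = ∑ (allFin h) λ x → ind (T ⊆? B ‼ x)

-- The expected total size under a uniform random colouring, multiplied by the number of colourings
-- so as to stay in ℕ.
totalSize : (Colouring m N → Vec (Subset N) h) → ℕ
totalSize {m} {N} {h} A = ∑ (allColourings m N) λ χ → ∑ (allFin h) λ x → ∣ A χ ‼ x ∣

-- The round that exposes colour `c`: `B` is the original family and `A` the current fragments.
-- Spreadness is asked of `B`, because every fragment at index `x` stays inside `B ‼ x`. The field
-- `invariant` expresses that `A` was computed from other colours: painting part of a fragment with
-- `c` leaves `A` as it was.
module Round {N m h k : ℕ} (B : Vec (Subset N) h) (A : Colouring m N → Vec (Subset N) h) (c : Fin m)
  (spread    : ∀ T → degree B T * (4 * m) ^ ∣ T ∣ ≤ h)
  (A⊆B       : ∀ χ x → A χ ‼ x ⊆ B ‼ x)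
  (∣A∣≤k     : ∀ χ x → ∣ A χ ‼ x ∣ ≤ k)
  (invariant : ∀ χ x T → T ⊆ A χ ‼ x → A (recolour T c χ) ≡ A χ)
  where

  A′ : Colouring m N → Vec (Subset N) h
  A′ χ = fragments (class c χ) (A χ)

  private
    χs = allColourings m N

    weight : Colouring m N → Subset N → ℕ
    weight χ = proj₁ (smallest-weight k (class c χ) (A χ) (∣A∣≤k χ))

    -- Recolouring the fragment T with c uncovers a smallest member A z of the family inside the colour class,
    -- and minimality of T forces T ⊆ A z.
    recolour-weight : ∀ χ x → let T = A′ χ ‼ x in
                      2 ^ (k ∸ ∣ A χ ‼ x ∣) ≤ weight (recolour T c χ) T
    recolour-weight χ x = begin
      -- The size condition in `Admissible` enters here: the sizes at `z`, `y` and `x` are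
      -- increasing in this order.
      2 ^ (k ∸ ∣ A χ ‼ x ∣)        ≤⟨ ^-monoʳ-≤ 2 (∸-monoʳ-≤ k (≤-trans ∣Az∣≤∣Ay∣ (proj₂ (best-admissible x)))) ⟩
      2 ^ (k ∸ ∣ A χ ‼ z ∣)        ≡⟨ cong (λ A″ → 2 ^ (k ∸ ∣ A″ ‼ z ∣)) (sym Aχ′≡Aχ) ⟩
      2 ^ (k ∸ ∣ A χ′ ‼ z ∣)       ≡⟨ sym (q≡ T (subst (λ A″ → T ⊆ A″ ‼ z) (sym Aχ′≡Aχ) (Subsetₚ.p─q⊆p _ W ∘ T⊆Az─W))) ⟩
      weight χ′ T                  ∎
      where
      open ≤-Reasoning
      W = class c χ
      open Fragment W (A χ)
      T = A′ χ ‼ x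
      χ′ = recolour T c χ
      W′ = class c χ′
      y = best x

      T≡ : T ≡ A χ ‼ y ─ W
      T≡ = fragments-‼ W (A χ) x

      Aχ′≡Aχ : A χ′ ≡ A χ
      Aχ′≡Aχ = invariant χ x T (proj₁ ∘ ∈-fragments⁻ W (A χ) x)

      -- The fragment `T` is exactly what the set at `y` lacked for lying in the colour class.
      Ay⊆W′ : A χ ‼ y ⊆ W′
      Ay⊆W′ {e} e∈Ay = case (e ∈? T) ,′ (e ∈? W) of λ where
        (yes e∈T , _)       → ∈-class⁺ {χ = χ′} (lookup-recolour-∈ χ e∈T)
        (no e∉T  , yes e∈W) → ∈-class⁺ {χ = χ′} (trans (lookup-recolour-∉ χ e e∉T) (∈-class⁻ {χ = χ} e∈W))
        (no e∉T  , no e∉W)  → contradiction (subst (e Subset.∈_) (sym T≡) (Subsetₚ.x∈p∧x∉q⇒x∈p─q e∈Ay e∉W)) e∉T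

      W′⊆W∪T : ∀ {e} → e Subset.∈ W′ → e Subset.∉ W → e Subset.∈ T
      W′⊆W∪T {e} e∈W′ e∉W = case e ∈? T of λ where
        (yes e∈T) → e∈T
        (no e∉T)  → contradiction (∈-class⁺ {χ = χ} (trans (sym (lookup-recolour-∉ χ e e∉T)) (∈-class⁻ {χ = χ′} e∈W′))) e∉W

      smallest = proj₂ (proj₂ (smallest-weight k W′ (A χ′) (∣A∣≤k χ′))) y (subst (λ A″ → A″ ‼ y ⊆ W′) (sym Aχ′≡Aχ) Ay⊆W′)
      z = proj₁ smallest
      q≡ = proj₂ (proj₂ (proj₂ smallest))

      Az⊆W′ : A χ ‼ z ⊆ W′
      Az⊆W′ = subst (λ A″ → A″ ‼ z ⊆ W′) Aχ′≡Aχ (proj₁ (proj₂ smallest))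

      ∣Az∣≤∣Ay∣ : ∣ A χ ‼ z ∣ ≤ ∣ A χ ‼ y ∣
      ∣Az∣≤∣Ay∣ = subst (λ A″ → ∣ A″ ‼ z ∣ ≤ ∣ A″ ‼ y ∣) Aχ′≡Aχ (proj₁ (proj₂ (proj₂ smallest)))

      Az─W⊆T : A χ ‼ z ─ W ⊆ T
      Az─W⊆T e∈ = W′⊆W∪T (Az⊆W′ (Subsetₚ.p─q⊆p _ W e∈)) (x∈p─q⇒x∉q _ W e∈)

      -- What the set at `z` has outside `W` lies in `T`, hence in the set at `x`. So `z` competes
      -- in the choice that produced `T`, and minimality bounds ∣ T ∣ by the size of its part
      -- outside `W`.
      z-admissible : Admissible x z
      z-admissible = Az⊆Ax∪W , ≤-trans ∣Az∣≤∣Ay∣ (proj₂ (best-admissible x))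
        where
        Az⊆Ax∪W : A χ ‼ z ⊆ A χ ‼ x ∪ W
        Az⊆Ax∪W {e} e∈Az = case e ∈? W of λ where
          (yes e∈W) → Subsetₚ.x∈p∪q⁺ (inj₂ e∈W)
          (no e∉W)  → Subsetₚ.x∈p∪q⁺ (inj₁ (proj₁ (∈-fragments⁻ W (A χ) x (W′⊆W∪T (Az⊆W′ e∈Az) e∉W))))

      T⊆Az─W : T ⊆ A χ ‼ z ─ W
      T⊆Az─W = p⊆q∧∣q∣≤∣p∣⇒q⊆p Az─W⊆T (≤-trans (≤-reflexive (cong ∣_∣ T≡)) (best-minimal x z z-admissible))

    -- Double counting, with `T` ranging over all subsets instead of the fragments. For fixed `T`
    -- there are at most `degree B T` indices `x`, and each recoloured colouring arises at most
    -- m^∣T∣ times; spreadness absorbs both factors together with 4^∣T∣. What remains is the total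
    -- weight, at most 2^k for each colouring.
    exponential-bound : ∑ χs (λ χ → ∑ (allFin h) λ x → 4 ^ ∣ A′ χ ‼ x ∣ * 2 ^ (k ∸ ∣ A χ ‼ x ∣)) ≤ length χs * (h * 2 ^ k)
    exponential-bound = begin
      ∑ χs (λ χ → ∑ (allFin h) λ x → 4 ^ ∣ A′ χ ‼ x ∣ * 2 ^ (k ∸ ∣ A χ ‼ x ∣))
        ≤⟨ ∑-mono χs (λ {χ} _ → ∑-mono (allFin h) (λ {x} _ → pointwise χ x)) ⟩
      ∑ χs (λ χ → ∑ (allFin h) λ x → ∑ Ts λ T → ind (T ⊆? B ‼ x) * g T (recolour T c χ))
        ≡⟨ ∑-cong χs (λ χ → ∑-swap (allFin h) Ts _) ⟩
      ∑ χs (λ χ → ∑ Ts λ T → ∑ (allFin h) λ x → ind (T ⊆? B ‼ x) * g T (recolour T c χ))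
        ≡⟨ ∑-swap χs Ts _ ⟩
      ∑ Ts (λ T → ∑ χs λ χ → ∑ (allFin h) λ x → ind (T ⊆? B ‼ x) * g T (recolour T c χ))
        ≤⟨ ∑-mono Ts (λ {T} _ → per-subset T) ⟩
      ∑ Ts (λ T → ∑ χs λ χ → h * weight χ T)
        ≡⟨ ∑-swap Ts χs _ ⟩
      ∑ χs (λ χ → ∑ Ts λ T → h * weight χ T)
        ≤⟨ ∑-≤-const χs _ (λ {χ} _ → ≤-trans (≤-reflexive (∑-distribˡ-* Ts h (weight χ)))
             (*-monoʳ-≤ h (proj₁ (proj₂ (smallest-weight k (class c χ) (A χ) (∣A∣≤k χ)))))) ⟩
      length χs * (h * 2 ^ k) ∎
      where
      open ≤-Reasoning
      Ts = allSubsets N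
      g : Subset N → Colouring m N → ℕ
      g T χ = 4 ^ ∣ T ∣ * weight χ T

      pointwise : ∀ χ x → 4 ^ ∣ A′ χ ‼ x ∣ * 2 ^ (k ∸ ∣ A χ ‼ x ∣) ≤
                          ∑ Ts λ T → ind (T ⊆? B ‼ x) * g T (recolour T c χ)
      pointwise χ x = begin
        4 ^ ∣ T ∣ * 2 ^ (k ∸ ∣ A χ ‼ x ∣)                        ≤⟨ *-monoʳ-≤ (4 ^ ∣ T ∣) (recolour-weight χ x) ⟩
        g T (recolour T c χ)                                    ≡⟨ sym (*-identityˡ _) ⟩
        1 * g T (recolour T c χ)                                ≡⟨ cong (_* g T (recolour T c χ)) (sym (ind-yes (T ⊆? B ‼ x) T⊆B)) ⟩
        ind (T ⊆? B ‼ x) * g T (recolour T c χ)                 ≤⟨ ∑-∈ (λ T → ind (T ⊆? B ‼ x) * g T (recolour T c χ)) (∈-allSubsets T) ⟩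
        (∑ Ts λ T → ind (T ⊆? B ‼ x) * g T (recolour T c χ))    ∎
        where
        T = A′ χ ‼ x
        T⊆B : T ⊆ B ‼ x
        T⊆B = A⊆B χ x ∘ proj₁ ∘ ∈-fragments⁻ (class c χ) (A χ) x

      per-subset : ∀ T → ∑ χs (λ χ → ∑ (allFin h) λ x → ind (T ⊆? B ‼ x) * g T (recolour T c χ)) ≤
                         ∑ χs λ χ → h * weight χ T
      per-subset T = begin
        ∑ χs (λ χ → ∑ (allFin h) λ x → ind (T ⊆? B ‼ x) * g T (recolour T c χ))
          ≡⟨ ∑-cong χs (λ χ → ∑-distribʳ-* (allFin h) (λ x → ind (T ⊆? B ‼ x)) _) ⟩
        ∑ χs (λ χ → degree B T * g T (recolour T c χ))
          ≡⟨ ∑-distribˡ-* χs (degree B T) _ ⟩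
        degree B T * ∑ χs (λ χ → g T (recolour T c χ))
          ≤⟨ *-monoʳ-≤ (degree B T) (∑-recolour T c (g T)) ⟩
        degree B T * (m ^ ∣ T ∣ * ∑ χs (g T))
          ≡⟨ cong (λ u → degree B T * (m ^ ∣ T ∣ * u)) (∑-distribˡ-* χs (4 ^ ∣ T ∣) _) ⟩
        degree B T * (m ^ ∣ T ∣ * (4 ^ ∣ T ∣ * ∑ χs (λ χ → weight χ T)))
          ≡⟨ regroup (degree B T) (m ^ ∣ T ∣) (4 ^ ∣ T ∣) _ ⟩
        degree B T * (4 ^ ∣ T ∣ * m ^ ∣ T ∣) * ∑ χs (λ χ → weight χ T)
          ≡⟨ cong (λ u → degree B T * u * ∑ χs (λ χ → weight χ T)) (sym (^-distribʳ-* ∣ T ∣ 4 m)) ⟩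
        degree B T * (4 * m) ^ ∣ T ∣ * ∑ χs (λ χ → weight χ T)
          ≤⟨ *-monoˡ-≤ _ (spread T) ⟩
        h * ∑ χs (λ χ → weight χ T)
          ≡⟨ sym (∑-distribˡ-* χs h _) ⟩
        (∑ χs λ χ → h * weight χ T) ∎
        where
        regroup : ∀ a b c d → a * (b * (c * d)) ≡ a * (c * b) * d
        regroup = solve-∀

  -- Sum `exponential-vs-linear` over all colourings and indices, with t the new size and l the old
  -- one. By `exponential-bound` the exponential terms are at most 2^k on average, which cancels
  -- against the summand 1 and leaves 2t ≤ l on average.
  halving : 2 * totalSize A′ ≤ totalSize A
  halving = *-cancelˡ-≤ (2 ^ k) {{m^n≢0 2 k}} (+-cancelˡ-≤ (length χs * (h * 2 ^ k)) _ _ (begin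
    length χs * (h * 2 ^ k) + 2 ^ k * (2 * totalSize A′)
      ≡⟨ cong₂ _+_ (sym (trans (∑-cong χs λ χ → trans (∑-const (allFin h) (2 ^ k)) (cong (_* 2 ^ k) (length-tabulate {n = h} id))) (∑-const χs _)))
                   (trans (sym (*-assoc (2 ^ k) 2 _)) (trans (sym (∑-distribˡ-* χs (2 ^ k * 2) _))
                     (∑-cong χs λ χ → sym (∑-distribˡ-* (allFin h) (2 ^ k * 2) _)))) ⟩
    ∑ χs (λ χ → ∑ (allFin h) λ x → 2 ^ k) + ∑ χs (λ χ → ∑ (allFin h) λ x → 2 ^ k * 2 * ∣ A′ χ ‼ x ∣)
      ≡⟨ sym (∑∑-distrib-+ (λ _ _ → 2 ^ k) (λ χ x → 2 ^ k * 2 * ∣ A′ χ ‼ x ∣)) ⟩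
    ∑ χs (λ χ → ∑ (allFin h) λ x → 2 ^ k + 2 ^ k * 2 * ∣ A′ χ ‼ x ∣)
      ≤⟨ ∑-mono χs (λ {χ} _ → ∑-mono (allFin h) λ {x} _ → ≤-trans (≤-reflexive (regroup (2 ^ k) ∣ A′ χ ‼ x ∣))
           (exponential-vs-linear ∣ A′ χ ‼ x ∣ ∣ A χ ‼ x ∣ (∣A∣≤k χ x))) ⟩
    ∑ χs (λ χ → ∑ (allFin h) λ x → 4 ^ ∣ A′ χ ‼ x ∣ * 2 ^ (k ∸ ∣ A χ ‼ x ∣) + 2 ^ k * ∣ A χ ‼ x ∣)
      ≡⟨ ∑∑-distrib-+ (λ χ x → 4 ^ ∣ A′ χ ‼ x ∣ * 2 ^ (k ∸ ∣ A χ ‼ x ∣)) (λ χ x → 2 ^ k * ∣ A χ ‼ x ∣) ⟩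
    ∑ χs (λ χ → ∑ (allFin h) λ x → 4 ^ ∣ A′ χ ‼ x ∣ * 2 ^ (k ∸ ∣ A χ ‼ x ∣)) + ∑ χs (λ χ → ∑ (allFin h) λ x → 2 ^ k * ∣ A χ ‼ x ∣)
      ≤⟨ +-mono-≤ exponential-bound (≤-reflexive (trans (∑-cong χs λ χ → ∑-distribˡ-* (allFin h) (2 ^ k) _) (∑-distribˡ-* χs (2 ^ k) _))) ⟩
    length χs * (h * 2 ^ k) + 2 ^ k * totalSize A ∎))
    where
    open ≤-Reasoning
    regroup : ∀ a b → a + a * 2 * b ≡ a * (1 + 2 * b)
    regroup = solve-∀
    ∑∑-distrib-+ : ∀ (f g : Colouring m N → Fin h → ℕ) →
      ∑ χs (λ χ → ∑ (allFin h) λ x → f χ x + g χ x) ≡ ∑ χs (λ χ → ∑ (allFin h) (f χ)) + ∑ χs (λ χ → ∑ (allFin h) (g χ))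
    ∑∑-distrib-+ f g = trans (∑-cong χs λ χ → ∑-distrib-+ (allFin h) (f χ) (g χ)) (∑-distrib-+ χs _ _)

-- Spread lemma: iterating the rounds

∣p∣≡0⇒x∉p : ∀ (p : Subset N) {e} → ∣ p ∣ ≡ 0 → e Subset.∉ p
∣p∣≡0⇒x∉p p ∣p∣≡0 e∈p = contradiction (subst (∣ p ─ ⁅ _ ⁆ ∣ <_) ∣p∣≡0 (Subsetₚ.x∈p⇒∣p-x∣<∣p∣ e∈p)) λ ()

module Rounds {N m h : ℕ} (B : Vec (Subset N) h) where

  -- The tail is processed first, so the head of the list is the colour exposed last.
  run : List (Fin m) → Colouring m N → Vec (Subset N) h
  run []       χ = B
  run (c ∷ cs) χ = fragments (class c χ) (run cs χ)

  run⊆B : ∀ cs χ x → run cs χ ‼ x ⊆ B ‼ x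
  run⊆B []       χ x e∈ = e∈
  run⊆B (c ∷ cs) χ x e∈ = run⊆B cs χ x (proj₁ (∈-fragments⁻ (class c χ) (run cs χ) x e∈))

  -- A fragment avoids the classes of all colours exposed so far, so painting part of it with a
  -- fresh colour `d` changes none of these classes. This supplies `invariant` for the next round.
  run-recolour : ∀ cs {d} → All (d ≢_) cs → ∀ χ x T → T ⊆ run cs χ ‼ x → run cs (recolour T d χ) ≡ run cs χ
  run-recolour []       d∉              χ x T T⊆ = refl
  run-recolour (c ∷ cs) {d} (d≢c ∷ d∉cs) χ x T T⊆ =
    cong₂ fragments (Subsetₚ.⊆-antisym forth back)
      (run-recolour cs d∉cs χ x T (proj₁ ∘ ∈-fragments⁻ (class c χ) (run cs χ) x ∘ T⊆))
    where
    forth : class c (recolour T d χ) ⊆ class c χ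
    forth {e} e∈ = case e ∈? T of λ where
      (yes e∈T) → contradiction (trans (sym (lookup-recolour-∈ χ e∈T)) (∈-class⁻ {χ = recolour T d χ} e∈)) d≢c
      (no e∉T)  → ∈-class⁺ {χ = χ} (trans (sym (lookup-recolour-∉ χ e e∉T)) (∈-class⁻ {χ = recolour T d χ} e∈))
    back : class c χ ⊆ class c (recolour T d χ)
    back {e} e∈ = case e ∈? T of λ where
      (yes e∈T) → contradiction e∈ (proj₂ (∈-fragments⁻ (class c χ) (run cs χ) x (T⊆ e∈T)))
      (no e∉T)  → ∈-class⁺ {χ = recolour T d χ} (trans (lookup-recolour-∉ χ e e∉T) (∈-class⁻ {χ = χ} e∈))

  -- Following the choices `best` back through the rounds leads to one original set `B ‼ y`; each
  -- element removed from it on the way has an exposed colour.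
  run-covers : ∀ cs χ x → ∃ λ y → ∀ {e} → e Subset.∈ B ‼ y → e Subset.∈ run cs χ ‼ x ⊎ lookup χ e ∈ cs
  run-covers []       χ x = x , inj₁
  run-covers (c ∷ cs) χ x = proj₁ ih , covers
    where
    ih = run-covers cs χ (Fragment.best (class c χ) (run cs χ) x)
    covers : ∀ {e} → e Subset.∈ B ‼ proj₁ ih → e Subset.∈ run (c ∷ cs) χ ‼ x ⊎ lookup χ e ∈ c ∷ cs
    covers {e} e∈B = case proj₂ ih e∈B ,′ (e ∈? class c χ) of λ where
      (inj₂ χe∈cs , _)      → inj₂ (there χe∈cs)
      (inj₁ _ , yes e∈c)    → inj₂ (here (∈-class⁻ {χ = χ} e∈c))
      (inj₁ e∈ , no e∉c)    → inj₁ (subst (e Subset.∈_) (sym (fragments-‼ (class c χ) (run cs χ) x)) (Subsetₚ.x∈p∧x∉q⇒x∈p─q e∈ e∉c))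

  module _ {k} (∣B∣≤k : ∀ x → ∣ B ‼ x ∣ ≤ k) (spread : ∀ T → degree B T * (4 * m) ^ ∣ T ∣ ≤ h) where

    totalSize-run : ∀ cs → Unique cs → 2 ^ length cs * totalSize (run cs) ≤ length (allColourings m N) * (h * k)
    totalSize-run [] _ = begin
      1 * totalSize (run [])                                                 ≡⟨ *-identityˡ _ ⟩
      totalSize (run [])                                                     ≡⟨ ∑-const (allColourings m N) _ ⟩
      length (allColourings m N) * ∑ (allFin h) (λ x → ∣ B ‼ x ∣)
        ≤⟨ *-monoʳ-≤ (length (allColourings m N)) (∑-≤-const (allFin h) k λ {x} _ → ∣B∣≤k x) ⟩
      length (allColourings m N) * (length (allFin h) * k)
        ≡⟨ cong (λ u → length (allColourings m N) * (u * k)) (length-tabulate {n = h} id) ⟩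
      length (allColourings m N) * (h * k)                                   ∎
      where open ≤-Reasoning
    totalSize-run (c ∷ cs) (c∉cs ∷ uniq) = begin
      2 * 2 ^ length cs * totalSize (run (c ∷ cs))   ≡⟨ regroup (2 ^ length cs) _ ⟩
      2 ^ length cs * (2 * totalSize (run (c ∷ cs))) ≤⟨ *-monoʳ-≤ (2 ^ length cs) (Round.halving B (run cs) c spread (run⊆B cs)
                                                          (λ χ x → ≤-trans (Subsetₚ.p⊆q⇒∣p∣≤∣q∣ (run⊆B cs χ x)) (∣B∣≤k x)) (run-recolour cs c∉cs)) ⟩
      2 ^ length cs * totalSize (run cs)             ≤⟨ totalSize-run cs uniq ⟩
      length (allColourings m N) * (h * k)           ∎
      where
      open ≤-Reasoning
      regroup : ∀ a b → 2 * a * b ≡ a * (2 * b)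
      regroup = solve-∀

    Good : List (Fin m) → Colouring m N → Set
    Good cs χ = ∃ λ x → ∣ run cs χ ‼ x ∣ ≡ 0

    good? : ∀ cs χ → Dec (Good cs χ)
    good? cs χ = any? λ x → ∣ run cs χ ‼ x ∣ ≟ 0

    good-covers : ∀ cs χ → Good cs χ → ∃ λ y → ∀ {e} → e Subset.∈ B ‼ y → lookup χ e ∈ cs
    good-covers cs χ (x , empty) = proj₁ (run-covers cs χ x) , λ e∈ → case proj₂ (run-covers cs χ x) e∈ of λ where
      (inj₁ e∈run) → contradiction e∈run (∣p∣≡0⇒x∉p (run cs χ ‼ x) empty)
      (inj₂ χe∈cs) → χe∈cs

    -- Markov's inequality: in a bad colouring all `h` final fragments are nonempty, so their total
    -- size is at least `h`, while its mean after r rounds is at most h k / 2^r.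
    bad-bound : ∀ .{{_ : NonZero h}} cs → Unique cs →
      2 ^ length cs * ∑ (allColourings m N) (λ χ → ind (¬? (good? cs χ))) ≤ length (allColourings m N) * k
    bad-bound cs uniq = *-cancelˡ-≤ h (begin
      h * (2 ^ length cs * ∑ χs (λ χ → ind (¬? (good? cs χ))))   ≡⟨ *-swap h (2 ^ length cs) _ ⟩
      2 ^ length cs * (h * ∑ χs (λ χ → ind (¬? (good? cs χ))))   ≡⟨ cong (2 ^ length cs *_) (sym (∑-distribˡ-* χs h _)) ⟩
      2 ^ length cs * ∑ χs (λ χ → h * ind (¬? (good? cs χ)))     ≤⟨ *-monoʳ-≤ (2 ^ length cs) (∑-mono χs λ {χ} _ → bad≤size χ) ⟩
      2 ^ length cs * totalSize (run cs)                       ≤⟨ totalSize-run cs uniq ⟩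
      length χs * (h * k)                                      ≡⟨ *-swap (length χs) h k ⟩
      h * (length χs * k)                                      ∎)
      where
      open ≤-Reasoning
      χs = allColourings m N
      *-swap : ∀ a b c → a * (b * c) ≡ b * (a * c)
      *-swap = solve-∀
      bad≤size : ∀ χ → h * ind (¬? (good? cs χ)) ≤ ∑ (allFin h) λ x → ∣ run cs χ ‼ x ∣
      bad≤size χ = ≤-trans (≤-reflexive (*-comm h _)) (ind-*-≤ (¬? (good? cs χ)) h λ ¬good → begin
        h                                       ≡⟨ sym (*-identityʳ h) ⟩
        h * 1                                   ≡⟨ cong (_* 1) (sym (length-tabulate {n = h} id)) ⟩
        length (allFin h) * 1                   ≡⟨ sym (∑-const (allFin h) 1) ⟩
        ∑ (allFin h) (λ _ → 1)                  ≤⟨ ∑-mono (allFin h) (λ {x} _ → n≢0⇒n>0 λ empty → ¬good (x , empty)) ⟩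
        ∑ (allFin h) (λ x → ∣ run cs χ ‼ x ∣)    ∎)

-- Family i owns the β colours combine i t, and each of them drives one round.
spread⇒rainbow-colouring : ∀ {N s β k} .{{_ : NonZero (s * β)}} (h : Fin s → ℕ) (B : ∀ i → Vec (Subset N) (h i)) →
  (∀ i → NonZero (h i)) → (∀ i x → ∣ B i ‼ x ∣ ≤ k) →
  (∀ i T → degree (B i) T * (4 * (s * β)) ^ ∣ T ∣ ≤ h i) → s * k < 2 ^ β →
  ∃ λ (χ : Colouring (s * β) N) → ∀ i → ∃ λ x → ∀ {e} → e Subset.∈ B i ‼ x → ∃ λ t → lookup χ e ≡ Fin.combine i t
spread⇒rainbow-colouring {N} {s} {β} {k} h B h≢0 ∣B∣≤k spread sk<2^β = χ , monochromatic
  where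
  open ≤-Reasoning
  χs = allColourings (s * β) N
  colours : Fin s → List (Fin (s * β))
  colours i = map (Fin.combine i) (allFin β)

  length-colours : ∀ i → length (colours i) ≡ β
  length-colours i = trans (length-map (Fin.combine i) (allFin β)) (length-tabulate {n = β} id)

  bad : Fin s → Colouring (s * β) N → ℕ
  bad i χ = ind (¬? (Rounds.good? (B i) (∣B∣≤k i) (spread i) (colours i) χ))

  bad-rare : ∀ i → 2 ^ β * ∑ χs (bad i) ≤ length χs * k
  bad-rare i = subst (λ u → 2 ^ u * ∑ χs (bad i) ≤ length χs * k) (length-colours i)
    (Rounds.bad-bound (B i) (∣B∣≤k i) (spread i) {{h≢0 i}} (colours i)
      (Uniqueₚ.map⁺ (λ {t} {u} → Finₚ.combine-injectiveʳ i t i u) (Uniqueₚ.allFin⁺ β)))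

  χs≢0 : NonZero (length χs)
  χs≢0 = subst NonZero (sym (trans (length-allVecs (allFin (s * β)) N) (cong (_^ N) (length-tabulate {n = s * β} id)))) (m^n≢0 (s * β) N)

  -- Union bound: each family is bad for at most a fraction k / 2^β of the colourings, and s k <
  -- 2^β.
  total-bad : ∑ χs (λ χ → ∑ (allFin s) λ i → bad i χ) < length χs
  total-bad = *-cancelˡ-< (2 ^ β) _ _ (begin-strict
    2 ^ β * ∑ χs (λ χ → ∑ (allFin s) λ i → bad i χ)  ≡⟨ cong (2 ^ β *_) (∑-swap χs (allFin s) _) ⟩
    2 ^ β * ∑ (allFin s) (λ i → ∑ χs (bad i))        ≡⟨ sym (∑-distribˡ-* (allFin s) (2 ^ β) _) ⟩
    ∑ (allFin s) (λ i → 2 ^ β * ∑ χs (bad i))        ≤⟨ ∑-≤-const (allFin s) (length χs * k) (λ {i} _ → bad-rare i) ⟩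
    length (allFin s) * (length χs * k)              ≡⟨ cong (_* (length χs * k)) (length-tabulate {n = s} id) ⟩
    s * (length χs * k)                              ≡⟨ regroup s (length χs) k ⟩
    s * k * length χs                                <⟨ *-monoˡ-< (length χs) {{χs≢0}} sk<2^β ⟩
    2 ^ β * length χs                                ∎)
    where
    regroup : ∀ a b c → a * (b * c) ≡ a * c * b
    regroup = solve-∀

  good-for-all = ∑<length⇒∃zero χs _ total-bad
  χ = proj₁ good-for-all

  good : ∀ i → Rounds.Good (B i) (∣B∣≤k i) (spread i) (colours i) χ
  good i = decidable-stable (Rounds.good? (B i) (∣B∣≤k i) (spread i) (colours i) χ) λ ¬good →
    contradiction (begin
      1                                 ≡⟨ sym (ind-yes (¬? (Rounds.good? (B i) (∣B∣≤k i) (spread i) (colours i) χ)) ¬good) ⟩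
      bad i χ                           ≤⟨ ∑-∈ (λ i → bad i χ) (∈-allFin i) ⟩
      ∑ (allFin s) (λ i → bad i χ)      ≡⟨ proj₂ good-for-all ⟩
      0                                 ∎) λ ()

  monochromatic : ∀ i → ∃ λ x → ∀ {e} → e Subset.∈ B i ‼ x → ∃ λ t → lookup χ e ≡ Fin.combine i t
  monochromatic i = proj₁ covering , λ e∈ → case ∈-map⁻ (Fin.combine i) (proj₂ covering e∈) of λ (t , _ , χe≡) → t , χe≡
    where covering = Rounds.good-covers (B i) (∣B∣≤k i) (spread i) (colours i) χ (good i)

-- Tuples as subsets of the grid; spread approximation

∣p++q∣≡∣p∣+∣q∣ : ∀ (p : Subset m) (q : Subset n) → ∣ p Vec.++ q ∣ ≡ ∣ p ∣ + ∣ q ∣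
∣p++q∣≡∣p∣+∣q∣ []          q = refl
∣p++q∣≡∣p∣+∣q∣ (true ∷ p)  q = cong suc (∣p++q∣≡∣p∣+∣q∣ p q)
∣p++q∣≡∣p∣+∣q∣ (false ∷ p) q = ∣p++q∣≡∣p∣+∣q∣ p q

++-⊆⁻ˡ : ∀ (p p′ : Subset m) {q q′ : Subset n} → p Vec.++ q ⊆ p′ Vec.++ q′ → p ⊆ p′
++-⊆⁻ˡ (_ ∷ p) (_ ∷ p′) sub here with here ← sub here = here
++-⊆⁻ˡ (_ ∷ p) (_ ∷ p′) sub (there e∈) = there (++-⊆⁻ˡ p p′ (Subsetₚ.drop-∷-⊆ sub) e∈)

++-⊆⁻ʳ : ∀ (p p′ : Subset m) {q q′ : Subset n} → p Vec.++ q ⊆ p′ Vec.++ q′ → q ⊆ q′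
++-⊆⁻ʳ []      []       sub = sub
++-⊆⁻ʳ (_ ∷ p) (_ ∷ p′) sub = ++-⊆⁻ʳ p p′ (Subsetₚ.drop-∷-⊆ sub)

toSet : Tuple n k → Subset (k * n)
toSet []      = []
toSet (x ∷ F) = ⁅ x ⁆ Vec.++ toSet F

∣toSet∣ : ∀ (F : Tuple n k) → ∣ toSet F ∣ ≡ k
∣toSet∣ []      = refl
∣toSet∣ (x ∷ F) = trans (∣p++q∣≡∣p∣+∣q∣ ⁅ x ⁆ (toSet F)) (cong₂ _+_ (Subsetₚ.∣⁅x⁆∣≡1 x) (∣toSet∣ F))

combine∈toSet : ∀ (F : Tuple n k) j → Fin.combine j (lookup F j) Subset.∈ toSet F
combine∈toSet {n} {suc k} (x ∷ F) zero    = lookup⇒[]= _ _ (trans (lookup-++ˡ ⁅ x ⁆ (toSet F) x) ([]=⇒lookup (Subsetₚ.x∈⁅x⁆ x)))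
combine∈toSet {n} {suc k} (x ∷ F) (suc j) = lookup⇒[]= _ _ (trans (lookup-++ʳ ⁅ x ⁆ (toSet F) _) ([]=⇒lookup (combine∈toSet F j)))

toSet-disjoint : ∀ (F F′ : Tuple n k) → (∀ {e} → e Subset.∈ toSet F → e Subset.∉ toSet F′) → Disjoint F F′
toSet-disjoint F F′ apart j Fj≡F′j =
  apart (combine∈toSet F j) (subst (λ x → Fin.combine j x Subset.∈ toSet F′) (sym Fj≡F′j) (combine∈toSet F′ j))

⁅x⁆⊆p : ∀ {p : Subset N} {x} → x Subset.∈ p → ⁅ x ⁆ ⊆ p
⁅x⁆⊆p {p = p} {x} x∈p y∈ = subst (Subset._∈ p) (sym (Subsetₚ.x∈⁅y⁆⇒x≡y x y∈)) x∈p

deg : List (Tuple n k) → Subset (k * n) → ℕ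
deg 𝓕 T = ∑ 𝓕 λ F → ind (T ⊆? toSet F)

-- An empty `T` admits all n points of the row; a nonempty one admits at most one point, and then
-- only if it has a single element.
row-count : ∀ (T : Subset n) → ∑ (allFin n) (λ x → ind (T ⊆? ⁅ x ⁆)) * n ^ ∣ T ∣ ≤ n
row-count {n} T with Subsetₚ.nonempty? T
... | no empty = begin
  ∑ (allFin n) (λ x → ind (T ⊆? ⁅ x ⁆)) * n ^ ∣ T ∣
    ≡⟨ cong (λ u → ∑ (allFin n) (λ x → ind (T ⊆? ⁅ x ⁆)) * n ^ u) (trans (cong ∣_∣ (Subsetₚ.Empty-unique empty)) (Subsetₚ.∣⊥∣≡0 n)) ⟩
  ∑ (allFin n) (λ x → ind (T ⊆? ⁅ x ⁆)) * 1           ≡⟨ *-identityʳ _ ⟩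
  ∑ (allFin n) (λ x → ind (T ⊆? ⁅ x ⁆))               ≤⟨ ∑-≤-const (allFin n) 1 (λ {x} _ → ind≤1 (T ⊆? ⁅ x ⁆)) ⟩
  length (allFin n) * 1                               ≡⟨ trans (*-identityʳ _) (length-tabulate {n = n} id) ⟩
  n                                                   ∎
  where open ≤-Reasoning
... | yes (e , e∈T) = begin
  ∑ (allFin n) (λ x → ind (T ⊆? ⁅ x ⁆)) * n ^ ∣ T ∣    ≡⟨ sym (∑-distribʳ-* (allFin n) (λ x → ind (T ⊆? ⁅ x ⁆)) _) ⟩
  ∑ (allFin n) (λ x → ind (T ⊆? ⁅ x ⁆) * n ^ ∣ T ∣)
    ≤⟨ ∑-unique-⊆ {ys = e ∷ []} (λ x → ind (T ⊆? ⁅ x ⁆) * n ^ ∣ T ∣) (Uniqueₚ.allFin⁺ n) (λ {x} _ pos → here (only x pos)) ⟩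
  ∑ (e ∷ []) (λ x → ind (T ⊆? ⁅ x ⁆) * n ^ ∣ T ∣)      ≡⟨ +-identityʳ (ind (T ⊆? ⁅ e ⁆) * n ^ ∣ T ∣) ⟩
  ind (T ⊆? ⁅ e ⁆) * n ^ ∣ T ∣
    ≤⟨ ind-*-≤ (T ⊆? ⁅ e ⁆) _ (λ T⊆ →
      ≤-trans (^-monoʳ-≤ n {{Finₚ.nonZeroIndex e}} (≤-trans (Subsetₚ.p⊆q⇒∣p∣≤∣q∣ T⊆) (≤-reflexive (Subsetₚ.∣⁅x⁆∣≡1 e)))) (≤-reflexive (*-identityʳ n))) ⟩
  n                                                   ∎
  where
  open ≤-Reasoning
  only : ∀ x → 0 < ind (T ⊆? ⁅ x ⁆) * n ^ ∣ T ∣ → x ≡ e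
  only x pos = case T ⊆? ⁅ x ⁆ of λ where
    (yes T⊆) → sym (Subsetₚ.x∈⁅y⁆⇒x≡y x (T⊆ e∈T))
    (no T⊈)  → contradiction (subst (λ u → 0 < u * n ^ ∣ T ∣) (ind-no (T ⊆? ⁅ x ⁆) T⊈) pos) λ ()

-- The rows are independent, so the count is a product of row counts. The factor n^∣T∣ on the left
-- avoids a truncated exponent k - ∣T∣; when ∣T∣ exceeds k the degree is 0.
deg-all : ∀ k (T : Subset (k * n)) → deg (allVecs (allFin n) k) T * n ^ ∣ T ∣ ≤ n ^ k
deg-all zero    [] = ≤-reflexive refl
deg-all {n} (suc k) T with T₁ , T₂ , refl ← Vec.splitAt n T = begin
  deg (allVecs (allFin n) (suc k)) (T₁ Vec.++ T₂) * n ^ ∣ T₁ Vec.++ T₂ ∣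
    ≡⟨ cong₂ _*_ (∑-allVecs-suc (allFin n) k _) (trans (cong (n ^_) (∣p++q∣≡∣p∣+∣q∣ T₁ T₂)) (^-distribˡ-+-* n ∣ T₁ ∣ ∣ T₂ ∣)) ⟩
  ∑ (allFin n) (λ x → ∑ Fs λ F → ind (T₁ Vec.++ T₂ ⊆? ⁅ x ⁆ Vec.++ toSet F)) * (n ^ ∣ T₁ ∣ * n ^ ∣ T₂ ∣)
    ≤⟨ *-monoˡ-≤ (n ^ ∣ T₁ ∣ * n ^ ∣ T₂ ∣) (∑-mono (allFin n) λ {x} _ → ∑-mono Fs λ {F} _ → split x F) ⟩
  ∑ (allFin n) (λ x → ∑ Fs λ F → ind (T₁ ⊆? ⁅ x ⁆) * ind (T₂ ⊆? toSet F)) * (n ^ ∣ T₁ ∣ * n ^ ∣ T₂ ∣)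
    ≡⟨ cong (_* (n ^ ∣ T₁ ∣ * n ^ ∣ T₂ ∣)) (trans (∑-cong (allFin n) λ x → ∑-distribˡ-* Fs (ind (T₁ ⊆? ⁅ x ⁆)) _) (∑-distribʳ-* (allFin n) _ _)) ⟩
  ∑ (allFin n) (λ x → ind (T₁ ⊆? ⁅ x ⁆)) * deg Fs T₂ * (n ^ ∣ T₁ ∣ * n ^ ∣ T₂ ∣)
    ≡⟨ regroup (∑ (allFin n) (λ x → ind (T₁ ⊆? ⁅ x ⁆))) (deg Fs T₂) (n ^ ∣ T₁ ∣) (n ^ ∣ T₂ ∣) ⟩
  ∑ (allFin n) (λ x → ind (T₁ ⊆? ⁅ x ⁆)) * n ^ ∣ T₁ ∣ * (deg Fs T₂ * n ^ ∣ T₂ ∣)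
    ≤⟨ *-mono-≤ (row-count T₁) (deg-all k T₂) ⟩
  n * n ^ k ∎
  where
  open ≤-Reasoning
  Fs = allVecs (allFin n) k
  regroup : ∀ a b c d → a * b * (c * d) ≡ a * c * (b * d)
  regroup = solve-∀
  split : ∀ x F → ind (T₁ Vec.++ T₂ ⊆? ⁅ x ⁆ Vec.++ toSet F) ≤ ind (T₁ ⊆? ⁅ x ⁆) * ind (T₂ ⊆? toSet F)
  split x F = ≤-trans (≤-reflexive (sym (*-identityʳ _))) (ind-*-≤ (T₁ Vec.++ T₂ ⊆? ⁅ x ⁆ Vec.++ toSet F) 1 λ T⊆ →
    ≤-reflexive (sym (cong₂ _*_ (ind-yes (T₁ ⊆? ⁅ x ⁆) (++-⊆⁻ˡ T₁ ⁅ x ⁆ T⊆)) (ind-yes (T₂ ⊆? toSet F) (++-⊆⁻ʳ T₁ ⁅ x ⁆ T⊆)))))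

deg-bound : ∀ {𝓕 : List (Tuple n k)} → Unique 𝓕 → ∀ T → deg 𝓕 T * n ^ ∣ T ∣ ≤ n ^ k
deg-bound {n} {k} uniq T = ≤-trans (*-monoˡ-≤ (n ^ ∣ T ∣) (∑-unique-⊆ _ uniq λ {F} _ _ → ∈-allVecs ∈-allFin F)) (deg-all k T)

module _ {n k : ℕ} (R : ℕ) where

  -- The field `spread` is R-spreadness of the link of `T` with denominators cleared: for `U`
  -- containing `T`, at most a fraction R^-(∣U∣ - ∣T∣) of the members contain `U`. In this form it
  -- is what maximality of `T` gives directly.
  record Core (𝓕 : List (Tuple n k)) (T : Subset (k * n)) : Set where
    field
      members  : List (Tuple n k)
      sub      : ∀ {F} → F ∈ members → F ∈ 𝓕
      nonempty : 0 < length members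
      contains : ∀ {F} → F ∈ members → T ⊆ toSet F
      spread   : ∀ U → deg members U * R ^ ∣ U ∣ ≤ length members * R ^ ∣ T ∣

  record Approximation (𝓕 : List (Tuple n k)) : Set where
    field
      cores : List (Subset (k * n))
      small : All (λ T → ∣ T ∣ ≤ 2) cores
      core  : All (Core 𝓕) cores
      -- f is any function dominating the indicator of the tuples that contain a core.
      bound : ∀ f → (∀ F → Any (λ T → T ⊆ toSet F) cores → 1 ≤ f F) →
              length 𝓕 * n ^ 3 ≤ ∑ 𝓕 f * n ^ 3 + R ^ 3 * n ^ k

  module _ .{{_ : NonZero n}} (R≤n : R ≤ n) where

    -- Maximality of deg T · R^∣T∣ makes the tuples through T spread over T.
    approximate : ∀ fuel (𝓕 : List (Tuple n k)) → Unique 𝓕 → length 𝓕 ≤ fuel → Approximation 𝓕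
    approximate _          []            _    _ = record { cores = [] ; small = [] ; core = [] ; bound = λ _ _ → z≤n }
    approximate (suc fuel) 𝓕@(F₀ ∷ 𝓕₀) uniq len = case ∣ T ∣ ≤? 2 of λ where
        (yes ∣T∣≤2) → extend ∣T∣≤2 (approximate fuel rest (Uniqueₚ.filter⁺ (¬? ∘ T⊆?) uniq) rest-shorter)
        -- Once the maximiser has at least three elements the peeling stops, and the whole remaining
        -- family goes into the error term.
        (no  ∣T∣≰2) → record { cores = [] ; small = [] ; core = [] ; bound = λ f _ → ≤-trans (few (≰⇒> ∣T∣≰2)) (m≤n+m _ _) }
      where
      open ≤-Reasoning
      value : Subset (k * n) → ℕ
      value U = deg 𝓕 U * R ^ ∣ U ∣

      T : Subset (k * n)
      T = argmax value Subset.⊥ (allSubsets (k * n))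

      T⊆? : ∀ F → Dec (T ⊆ toSet F)
      T⊆? F = T ⊆? toSet F

      through rest : List (Tuple n k)
      through = filter T⊆? 𝓕
      rest    = filter (¬? ∘ T⊆?) 𝓕

      value-max : ∀ U → value U ≤ length through * R ^ ∣ T ∣
      value-max U = ≤-trans (All.lookup (f[xs]≤f[argmax] {f = value} Subset.⊥ (allSubsets (k * n))) (∈-allSubsets U))
        (≤-reflexive (cong (_* R ^ ∣ T ∣) (sym (length-filter≡∑ T⊆? 𝓕))))

      -- The empty set competes in the maximum, and its value is the size of the family.
      length≤ : length 𝓕 ≤ length through * R ^ ∣ T ∣
      length≤ = begin
        length 𝓕             ≡⟨ length≡∑1 𝓕 ⟩
        ∑ 𝓕 (λ _ → 1)        ≡⟨ ∑-cong 𝓕 (λ F → sym (ind-yes (Subset.⊥ ⊆? toSet F) Subsetₚ.⊥⊆)) ⟩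
        deg 𝓕 Subset.⊥       ≡⟨ sym (*-identityʳ _) ⟩
        deg 𝓕 Subset.⊥ * R ^ 0 ≡⟨ cong (λ u → deg 𝓕 Subset.⊥ * R ^ u) (sym (Subsetₚ.∣⊥∣≡0 (k * n))) ⟩
        value Subset.⊥       ≤⟨ value-max Subset.⊥ ⟩
        length through * R ^ ∣ T ∣ ∎

      through≢[] : 0 < length through
      through≢[] = n≢0⇒n>0 λ eq → contradiction (subst (λ u → length 𝓕 ≤ u * R ^ ∣ T ∣) eq length≤) λ ()

      T-core : Core 𝓕 T
      T-core = record
        { members  = through
        ; sub      = λ F∈ → proj₁ (∈-filter⁻ T⊆? {xs = 𝓕} F∈)
        ; nonempty = through≢[]
        ; contains = λ F∈ → proj₂ (∈-filter⁻ T⊆? {xs = 𝓕} F∈)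
        ; spread   = λ U → ≤-trans (*-monoˡ-≤ (R ^ ∣ U ∣) (∑-filter-≤ T⊆? 𝓕 _)) (value-max U)
        }

      partition : length 𝓕 ≡ length through + length rest
      partition = length-partition T⊆? 𝓕

      rest-shorter : length rest ≤ fuel
      rest-shorter = s≤s⁻¹ (begin
        suc (length rest)               ≤⟨ +-monoˡ-≤ (length rest) through≢[] ⟩
        length through + length rest    ≡⟨ sym partition ⟩
        length 𝓕                        ≤⟨ len ⟩
        suc fuel                        ∎)

      -- The family has at most (R/n)^∣T∣ n^k tuples, and R ≤ n with ∣T∣ ≥ 3 allows the exponent to
      -- be lowered to 3. Both sides are multiplied by n^j to stay in ℕ.
      few : 2 < ∣ T ∣ → length 𝓕 * n ^ 3 ≤ R ^ 3 * n ^ k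
      few 2<∣T∣ = *-cancelʳ-≤ _ _ (n ^ j) {{m^n≢0 n j}} (begin
        length 𝓕 * n ^ 3 * n ^ j
          ≡⟨ trans (*-assoc (length 𝓕) (n ^ 3) (n ^ j)) (cong (length 𝓕 *_) (trans (sym (^-distribˡ-+-* n 3 j)) (cong (n ^_) 3+j≡))) ⟩
        length 𝓕 * n ^ ∣ T ∣                            ≤⟨ *-monoˡ-≤ (n ^ ∣ T ∣) length≤ ⟩
        length through * R ^ ∣ T ∣ * n ^ ∣ T ∣          ≡⟨ regroup₁ (length through) (R ^ ∣ T ∣) (n ^ ∣ T ∣) ⟩
        R ^ ∣ T ∣ * (length through * n ^ ∣ T ∣)        ≡⟨ cong (λ u → R ^ ∣ T ∣ * (u * n ^ ∣ T ∣)) (length-filter≡∑ T⊆? 𝓕) ⟩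
        R ^ ∣ T ∣ * (deg 𝓕 T * n ^ ∣ T ∣)               ≤⟨ *-monoʳ-≤ (R ^ ∣ T ∣) (deg-bound uniq T) ⟩
        R ^ ∣ T ∣ * n ^ k                               ≡⟨ cong (_* n ^ k) (trans (cong (R ^_) (sym 3+j≡)) (^-distribˡ-+-* R 3 j)) ⟩
        R ^ 3 * R ^ j * n ^ k                           ≤⟨ *-monoˡ-≤ (n ^ k) (*-monoʳ-≤ (R ^ 3) (^-monoˡ-≤ j R≤n)) ⟩
        R ^ 3 * n ^ j * n ^ k                           ≡⟨ regroup₂ (R ^ 3) (n ^ j) (n ^ k) ⟩
        R ^ 3 * n ^ k * n ^ j                           ∎)
        where
        j = ∣ T ∣ ∸ 3
        3+j≡ : 3 + j ≡ ∣ T ∣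
        3+j≡ = m+[n∸m]≡n 2<∣T∣
        regroup₁ : ∀ a b c → a * b * c ≡ b * (a * c)
        regroup₁ = solve-∀
        regroup₂ : ∀ a b c → a * b * c ≡ a * c * b
        regroup₂ = solve-∀

      extend : ∣ T ∣ ≤ 2 → Approximation rest → Approximation 𝓕
      extend ∣T∣≤2 rec = record
        { cores = T ∷ cores
        ; small = ∣T∣≤2 ∷ small
        ; core  = T-core ∷ All.map (λ C → record { Core C ; sub = λ F∈ → proj₁ (∈-filter⁻ (¬? ∘ T⊆?) {xs = 𝓕} (Core.sub C F∈)) }) core
        -- The tuples through `T` are counted by `f`, as `T` is now a core. The error is inherited
        -- from `rest` unchanged, so it is paid at most once in the whole recursion.
        ; bound = λ f f≥1 → begin
            length 𝓕 * n ^ 3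
              ≡⟨ trans (cong (_* n ^ 3) partition) (*-distribʳ-+ (n ^ 3) (length through) _) ⟩
            length through * n ^ 3 + length rest * n ^ 3
              ≤⟨ +-mono-≤ (*-monoˡ-≤ (n ^ 3) (≤-trans (≤-reflexive (length≡∑1 through))
                   (∑-mono through λ F∈ → f≥1 _ (here (proj₂ (∈-filter⁻ T⊆? {xs = 𝓕} F∈))))))
                   (bound f λ F any → f≥1 F (there any)) ⟩
            ∑ through f * n ^ 3 + (∑ rest f * n ^ 3 + R ^ 3 * n ^ k)
              ≡⟨ sym (+-assoc (∑ through f * n ^ 3) _ _) ⟩
            ∑ through f * n ^ 3 + ∑ rest f * n ^ 3 + R ^ 3 * n ^ k
              ≡⟨ cong (_+ R ^ 3 * n ^ k) (trans (sym (*-distribʳ-+ (n ^ 3) (∑ through f) _)) (cong (_* n ^ 3) (sym (∑-partition T⊆? 𝓕 f)))) ⟩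
            ∑ 𝓕 f * n ^ 3 + R ^ 3 * n ^ k ∎
        }
        where open Approximation rec

-- Choosing disjoint cores

elements : Subset N → List (Fin N)
elements []          = []
elements (true ∷ p)  = zero ∷ map suc (elements p)
elements (false ∷ p) = map suc (elements p)

length-elements : ∀ (p : Subset N) → length (elements p) ≡ ∣ p ∣
length-elements []          = refl
length-elements (true ∷ p)  = cong suc (trans (length-map suc (elements p)) (length-elements p))
length-elements (false ∷ p) = trans (length-map suc (elements p)) (length-elements p)

∈-elements⁺ : ∀ {p : Subset N} {e} → e Subset.∈ p → e ∈ elements p
∈-elements⁺ {p = true ∷ p}  here       = here refl
∈-elements⁺ {p = true ∷ p}  (there e∈) = there (∈-map⁺ suc (∈-elements⁺ e∈))
∈-elements⁺ {p = false ∷ p} (there e∈) = ∈-map⁺ suc (∈-elements⁺ e∈)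

∈-elements⁻ : ∀ {p : Subset N} {e} → e ∈ elements p → e Subset.∈ p
∈-elements⁻ {p = true ∷ p}  (here refl) = here
∈-elements⁻ {p = true ∷ p}  (there e∈) with e , e∈p , refl ← ∈-map⁻ suc e∈ = there (∈-elements⁻ e∈p)
∈-elements⁻ {p = false ∷ p} e∈         with e , e∈p , refl ← ∈-map⁻ suc e∈ = there (∈-elements⁻ e∈p)

Meets : Subset N → Subset N → Set
Meets p q = ∃ λ e → e Subset.∈ p × e Subset.∈ q

meets? : ∀ (p q : Subset N) → Dec (Meets p q)
meets? p q = any? λ e → (e ∈? p) ×-dec (e ∈? q)

module _ (q : ℕ) (𝒮 : List (Subset N)) where

  -- However q further elements are forbidden, a set represented by P can be replaced by a member of 𝒮.
  Extendable : Subset N → Set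
  Extendable P = ∀ X → ∣ X ∣ ≤ q → ¬ Meets X P → Any (λ T → ¬ Meets T X) 𝒮

  -- A counterexample to `Extendable P`. Its existence is decidable on a finite ground set, which
  -- makes the case distinction below constructive.
  Blocks : Subset N → Subset N → Set
  Blocks P X = ∣ X ∣ ≤ q × ¬ Meets X P × All (λ T → Meets T X) 𝒮

  blocked? : ∀ P → Dec (∃ (Blocks P))
  blocked? P = Subsetₚ.anySubset? λ X → (∣ X ∣ ≤? q) ×-dec ¬? (meets? X P) ×-dec All.all? (λ T → meets? T X) 𝒮

  ¬blocked⇒extendable : ∀ {P} → ¬ ∃ (Blocks P) → Extendable P
  ¬blocked⇒extendable ¬blocked X ∣X∣≤q ¬meets = decidable-stable (Any.any? (λ T → ¬? (meets? T X)) 𝒮) λ ¬any →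
    ¬blocked (X , ∣X∣≤q , ¬meets , All.map (λ {T} → decidable-stable (meets? T X)) (Allₚ.¬Any⇒All¬ 𝒮 ¬any))

  heavy : List (Fin N)
  heavy = filter (λ x → ¬? (blocked? ⁅ x ⁆)) (allFin N)

  heavy-unique : Unique heavy
  heavy-unique = Uniqueₚ.filter⁺ (λ x → ¬? (blocked? ⁅ x ⁆)) (Uniqueₚ.allFin⁺ N)

  heavy⇒extendable : ∀ {x} → x ∈ heavy → Extendable ⁅ x ⁆
  heavy⇒extendable x∈ = ¬blocked⇒extendable (proj₂ (∈-filter⁻ (λ x → ¬? (blocked? ⁅ x ⁆)) {xs = allFin N} x∈))

  -- The set `Y` blocking a point `x` misses `x` but meets every core, so a core through `x`
  -- contains a second point from a list of at most `q`. The decision is an argument so that facts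
  -- about the list can be proved by matching on it.
  blocker : ∀ x → Dec (∃ (Blocks ⁅ x ⁆)) → List (Fin N)
  blocker x (yes (Y , _)) = elements Y
  blocker x (no _)        = []

  length-blocker : ∀ x d → length (blocker x d) ≤ q
  length-blocker x (yes (Y , ∣Y∣≤q , _)) = ≤-trans (≤-reflexive (length-elements Y)) ∣Y∣≤q
  length-blocker x (no _)                = z≤n

  blocker-≢ : ∀ x d {y} → y ∈ blocker x d → x ≢ y
  blocker-≢ x (yes (Y , _ , ¬meets , _)) y∈ refl = ¬meets (x , ∈-elements⁻ y∈ , Subsetₚ.x∈⁅x⁆ x)

  blocker-meets : ∀ x d → ∃ (Blocks ⁅ x ⁆) → ∀ {T} → T ∈ 𝒮 → ∃ λ y → y ∈ blocker x d × y Subset.∈ T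
  blocker-meets x (yes (Y , _ , _ , all)) _ T∈ with y , y∈T , y∈Y ← All.lookup all T∈ = y , ∈-elements⁺ y∈Y , y∈T
  blocker-meets x (no ¬b)                 b T∈ = contradiction b ¬b

pair : Fin N → Fin N → Subset N
pair x y = ⁅ x ⁆ ∪ ⁅ y ⁆

2≤∣pair∣ : ∀ {x y : Fin N} → x ≢ y → 2 ≤ ∣ pair x y ∣
2≤∣pair∣ {x = x} {y} x≢y = ≤-trans (≤-reflexive (sym (cong₂ _+_ (Subsetₚ.∣⁅x⁆∣≡1 x) (Subsetₚ.∣⁅x⁆∣≡1 y))))
  (disjoint⇒∣p∣+∣q∣≤∣p∪q∣ ⁅ x ⁆ ⁅ y ⁆ λ e∈x e∈y → x≢y (trans (sym (Subsetₚ.x∈⁅y⁆⇒x≡y x e∈x)) (Subsetₚ.x∈⁅y⁆⇒x≡y y e∈y)))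

pair⊆ : ∀ {p : Subset N} {x y} → x Subset.∈ p → y Subset.∈ p → pair x y ⊆ p
pair⊆ {x = x} {y} x∈p y∈p e∈ = case Subsetₚ.x∈p∪q⁻ ⁅ x ⁆ ⁅ y ⁆ e∈ of λ where
  (inj₁ e∈x) → ⁅x⁆⊆p x∈p e∈x
  (inj₂ e∈y) → ⁅x⁆⊆p y∈p e∈y

-- If X blocks ∅, each core meets X, and either in a heavy element or in some x ∈ X and also in the blocker of x.
blocked-bound : ∀ {n k R q} .{{_ : NonZero n}} {𝓕 : List (Tuple n k)} → Unique 𝓕 → (S : Approximation R 𝓕) →
  let open Approximation S in ∃ (Blocks q cores Subset.⊥) →
  length 𝓕 * n ^ 3 ≤ length (heavy q cores) * n ^ (2 + k) + q * q * n ^ (1 + k) + R ^ 3 * n ^ k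
blocked-bound {n} {k} {R} {q} {𝓕} uniq S (X , ∣X∣≤q , _ , X-meets) = ≤-trans (bound f f≥1) (+-monoˡ-≤ (R ^ 3 * n ^ k) ∑f≤)
  where
  open ≤-Reasoning
  open Approximation S
  H : List (Fin (k * n))
  H = heavy q cores
  partners : Fin (k * n) → List (Fin (k * n))
  partners x = blocker q cores x (blocked? q cores ⁅ x ⁆)

  -- A heavy point costs at most n^(k-1) tuples; each of the at most q² pairs costs at most n^(k-2).
  f₁ f₂ f : Tuple n k → ℕ
  f₁ F = ∑ H λ x → ind (⁅ x ⁆ ⊆? toSet F)
  f₂ F = ∑ (elements X) λ x → ∑ (partners x) λ y → ind (pair x y ⊆? toSet F)
  f F = f₁ F + f₂ F

  f≥1 : ∀ F → Any (λ T → T ⊆ toSet F) cores → 1 ≤ f F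
  f≥1 F any = case blocked? q cores ⁅ x ⁆ of λ where
      (no ¬blocked) → ≤-trans (≤-trans (≤-reflexive (sym (ind-yes (⁅ x ⁆ ⊆? toSet F) (⁅x⁆⊆p (T⊆F x∈T)))))
                        (∑-∈ (λ x → ind (⁅ x ⁆ ⊆? toSet F)) (∈-filter⁺ (λ x → ¬? (blocked? q cores ⁅ x ⁆)) (∈-allFin x) ¬blocked))) (m≤m+n (f₁ F) (f₂ F))
      (yes blocked) → case blocker-meets q cores x (blocked? q cores ⁅ x ⁆) blocked T∈ of λ where
        (y , y∈ , y∈T) → ≤-trans (≤-trans (≤-trans (≤-reflexive (sym (ind-yes (pair x y ⊆? toSet F) (pair⊆ (T⊆F x∈T) (T⊆F y∈T)))))
                           (∑-∈ (λ y → ind (pair x y ⊆? toSet F)) y∈)) (∑-∈ (λ x → ∑ (partners x) λ y → ind (pair x y ⊆? toSet F)) (∈-elements⁺ x∈X))) (m≤n+m (f₂ F) (f₁ F))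
    where
    T∈′ = find any
    T = proj₁ T∈′
    T∈ = proj₁ (proj₂ T∈′)
    T⊆F : T ⊆ toSet F
    T⊆F = proj₂ (proj₂ T∈′)
    meet = All.lookup X-meets T∈
    x = proj₁ meet
    x∈T = proj₁ (proj₂ meet)
    x∈X = proj₂ (proj₂ meet)

  singles : ∑ 𝓕 f₁ * n ^ 3 ≤ length H * n ^ (2 + k)
  singles = begin
    ∑ 𝓕 f₁ * n ^ 3                         ≡⟨ cong (_* n ^ 3) (∑-swap 𝓕 H _) ⟩
    ∑ H (λ x → deg 𝓕 ⁅ x ⁆) * n ^ 3        ≡⟨ sym (∑-distribʳ-* H _ (n ^ 3)) ⟩
    ∑ H (λ x → deg 𝓕 ⁅ x ⁆ * n ^ 3)        ≤⟨ ∑-≤-const H _ (λ {x} _ → single x) ⟩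
    length H * n ^ (2 + k)                 ∎
    where
    single : ∀ x → deg 𝓕 ⁅ x ⁆ * n ^ 3 ≤ n ^ (2 + k)
    single x = begin
      deg 𝓕 ⁅ x ⁆ * n ^ 3             ≡⟨ cong (deg 𝓕 ⁅ x ⁆ *_) (^-distribˡ-+-* n 1 2) ⟩
      deg 𝓕 ⁅ x ⁆ * (n ^ 1 * n ^ 2)   ≡⟨ sym (*-assoc (deg 𝓕 ⁅ x ⁆) (n ^ 1) (n ^ 2)) ⟩
      deg 𝓕 ⁅ x ⁆ * n ^ 1 * n ^ 2     ≡⟨ cong (λ u → deg 𝓕 ⁅ x ⁆ * n ^ u * n ^ 2) (sym (Subsetₚ.∣⁅x⁆∣≡1 x)) ⟩
      deg 𝓕 ⁅ x ⁆ * n ^ ∣ ⁅ x ⁆ ∣ * n ^ 2 ≤⟨ *-monoˡ-≤ (n ^ 2) (deg-bound uniq ⁅ x ⁆) ⟩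
      n ^ k * n ^ 2                   ≡⟨ trans (*-comm (n ^ k) (n ^ 2)) (sym (^-distribˡ-+-* n 2 k)) ⟩
      n ^ (2 + k)                     ∎

  pairs : ∑ 𝓕 f₂ * n ^ 3 ≤ q * q * n ^ (1 + k)
  pairs = begin
    ∑ 𝓕 f₂ * n ^ 3
      ≡⟨ cong (_* n ^ 3) (trans (∑-swap 𝓕 (elements X) _) (∑-cong (elements X) λ x → ∑-swap 𝓕 (partners x) _)) ⟩
    ∑ (elements X) (λ x → ∑ (partners x) λ y → deg 𝓕 (pair x y)) * n ^ 3
      ≡⟨ trans (sym (∑-distribʳ-* (elements X) _ (n ^ 3))) (∑-cong (elements X) λ x → sym (∑-distribʳ-* (partners x) _ (n ^ 3))) ⟩
    ∑ (elements X) (λ x → ∑ (partners x) λ y → deg 𝓕 (pair x y) * n ^ 3)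
      ≤⟨ ∑-≤-const (elements X) _ (λ {x} _ → ≤-trans (∑-≤-const (partners x) (n ^ (1 + k)) λ y∈ → single (blocker-≢ q cores x (blocked? q cores ⁅ x ⁆) y∈))
           (*-monoˡ-≤ (n ^ (1 + k)) (length-blocker q cores x (blocked? q cores ⁅ x ⁆)))) ⟩
    length (elements X) * (q * n ^ (1 + k))
      ≤⟨ *-monoˡ-≤ (q * n ^ (1 + k)) (≤-trans (≤-reflexive (length-elements X)) ∣X∣≤q) ⟩
    q * (q * n ^ (1 + k))
      ≡⟨ sym (*-assoc q q _) ⟩
    q * q * n ^ (1 + k) ∎
    where
    single : ∀ {x y} → x ≢ y → deg 𝓕 (pair x y) * n ^ 3 ≤ n ^ (1 + k)
    single {x} {y} x≢y = begin
      deg 𝓕 (pair x y) * n ^ 3                 ≡⟨ cong (deg 𝓕 (pair x y) *_) (*-comm n (n ^ 2)) ⟩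
      deg 𝓕 (pair x y) * (n ^ 2 * n)           ≡⟨ sym (*-assoc (deg 𝓕 (pair x y)) (n ^ 2) n) ⟩
      deg 𝓕 (pair x y) * n ^ 2 * n             ≤⟨ *-monoˡ-≤ n (*-monoʳ-≤ (deg 𝓕 (pair x y)) (^-monoʳ-≤ n (2≤∣pair∣ x≢y))) ⟩
      deg 𝓕 (pair x y) * n ^ ∣ pair x y ∣ * n  ≤⟨ *-monoˡ-≤ n (deg-bound uniq (pair x y)) ⟩
      n ^ k * n                                ≡⟨ *-comm (n ^ k) n ⟩
      n ^ (1 + k)                              ∎

  ∑f≤ : ∑ 𝓕 f * n ^ 3 ≤ length H * n ^ (2 + k) + q * q * n ^ (1 + k)
  ∑f≤ = begin
    ∑ 𝓕 f * n ^ 3                             ≡⟨ cong (_* n ^ 3) (∑-distrib-+ 𝓕 f₁ f₂) ⟩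
    (∑ 𝓕 f₁ + ∑ 𝓕 f₂) * n ^ 3                 ≡⟨ *-distribʳ-+ (n ^ 3) (∑ 𝓕 f₁) _ ⟩
    ∑ 𝓕 f₁ * n ^ 3 + ∑ 𝓕 f₂ * n ^ 3           ≤⟨ +-mono-≤ singles pairs ⟩
    length H * n ^ (2 + k) + q * q * n ^ (1 + k) ∎

¬Meets-sym : ∀ {p q : Subset N} → ¬ Meets p q → ¬ Meets q p
¬Meets-sym ¬m (e , e∈q , e∈p) = ¬m (e , e∈p , e∈q)

length≤1+remaining : ∀ {p : Subset N} → ∣ p ∣ ≤ 1 → ∀ {L} → Unique L → length L ≤ 1 + length (filter (λ x → ¬? (x ∈? p)) L)
length≤1+remaining {p = p} ∣p∣≤1 {L} uniq = begin
  length L                                                              ≡⟨ length-partition (_∈? p) L ⟩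
  length (filter (_∈? p) L) + length (filter (λ x → ¬? (x ∈? p)) L)     ≤⟨ +-monoˡ-≤ (length (filter (λ x → ¬? (x ∈? p)) L)) removed ⟩
  1 + length (filter (λ x → ¬? (x ∈? p)) L)                             ∎
  where
  open ≤-Reasoning
  removed : length (filter (_∈? p) L) ≤ 1
  removed = begin
    length (filter (_∈? p) L)                  ≡⟨ length-filter≡∑ (_∈? p) L ⟩
    ∑ L (λ x → ind (x ∈? p))                   ≤⟨ ∑-unique-⊆ _ uniq (λ {x} _ pos → ∈-elements⁺ (ind>0 (x ∈? p) pos)) ⟩
    ∑ (elements p) (λ x → ind (x ∈? p))        ≤⟨ ∑-≤-const (elements p) 1 (λ {x} _ → ind≤1 (x ∈? p)) ⟩
    length (elements p) * 1                    ≡⟨ trans (*-identityʳ _) (length-elements p) ⟩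
    ∣ p ∣                                      ≤⟨ ∣p∣≤1 ⟩
    1                                          ∎

PairwiseDisjoint : (Fin s → Subset N) → Set
PairwiseDisjoint P = ∀ i j → i ≢ j → ¬ Meets (P i) (P j)

-- Greedy choice: when index i is reached, at most toℕ i elements have been used.
disjoint-representatives : ∀ {s N} (E : Fin s → Subset N → Set) →
  (∀ i → E i Subset.⊥ ⊎ ∃ λ L → Unique L × toℕ i < length L × (∀ {x} → x ∈ L → E i ⁅ x ⁆)) →
  ∃ λ P → (∀ i → E i (P i)) × (∀ i → ∣ P i ∣ ≤ 1) × PairwiseDisjoint P
disjoint-representatives {zero}      E options = (λ ()) , (λ ()) , (λ ()) , λ ()
disjoint-representatives {suc s} {N} E options = P , P-E , P-small , P-disjoint
  where
  first : ∃ λ p → E zero p × ∣ p ∣ ≤ 1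
  first with options zero
  ... | inj₁ E⊥                       = Subset.⊥ , E⊥ , ≤-trans (≤-reflexive (Subsetₚ.∣⊥∣≡0 N)) z≤n
  ... | inj₂ (x ∷ _ , _ , _ , E⁅⁆) = ⁅ x ⁆ , E⁅⁆ (here refl) , ≤-reflexive (Subsetₚ.∣⁅x⁆∣≡1 x)
  p₀ : Subset N
  p₀ = proj₁ first
  ∣p₀∣≤1 : ∣ p₀ ∣ ≤ 1
  ∣p₀∣≤1 = proj₂ (proj₂ first)

  E′ : Fin s → Subset N → Set
  E′ i p′ = E (suc i) p′ × ¬ Meets p₀ p′

  options′ : ∀ i → E′ i Subset.⊥ ⊎ ∃ λ L → Unique L × toℕ i < length L × (∀ {x} → x ∈ L → E′ i ⁅ x ⁆)
  options′ i with options (suc i)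
  ... | inj₁ E⊥                      = inj₁ (E⊥ , λ (_ , _ , e∈⊥) → Subsetₚ.∉⊥ e∈⊥)
  ... | inj₂ (L , uniq , long , E⁅⁆) =
    -- Avoiding `p₀` removes at most one entry of the list, and the index drops by one at the same
    -- time.
    inj₂ (filter (λ x → ¬? (x ∈? p₀)) L , Uniqueₚ.filter⁺ (λ x → ¬? (x ∈? p₀)) uniq , s≤s⁻¹ (≤-trans long (length≤1+remaining ∣p₀∣≤1 uniq))
         , λ {x} x∈ → case ∈-filter⁻ (λ x → ¬? (x ∈? p₀)) {xs = L} x∈ of λ where
             (x∈L , x∉p) → E⁅⁆ x∈L , λ (e , e∈p , e∈x) → x∉p (subst (Subset._∈ p₀) (Subsetₚ.x∈⁅y⁆⇒x≡y x e∈x) e∈p))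

  rec = disjoint-representatives E′ options′

  P : Fin (suc s) → Subset N
  P zero    = p₀
  P (suc i) = proj₁ rec i
  P-E : ∀ i → E i (P i)
  P-E zero    = proj₁ (proj₂ first)
  P-E (suc i) = proj₁ (proj₁ (proj₂ rec) i)
  P-small : ∀ i → ∣ P i ∣ ≤ 1
  P-small zero    = ∣p₀∣≤1
  P-small (suc i) = proj₁ (proj₂ (proj₂ rec)) i
  P-disjoint : PairwiseDisjoint P
  P-disjoint zero    zero    i≢j = contradiction refl i≢j
  P-disjoint zero    (suc j) _   = proj₂ (proj₁ (proj₂ rec) j)
  P-disjoint (suc i) zero    _   = ¬Meets-sym (proj₂ (proj₁ (proj₂ rec) i))
  P-disjoint (suc i) (suc j) i≢j = proj₂ (proj₂ (proj₂ rec)) i j (i≢j ∘ cong suc)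

others : (Fin (suc s) → Subset N) → Fin (suc s) → Subset N
others P i = ⋃ (List.tabulate (P ∘ Fin.punchIn i))

∣⋃∣≤ : ∀ {c} (ps : List (Subset N)) → All (λ p → ∣ p ∣ ≤ c) ps → ∣ ⋃ ps ∣ ≤ length ps * c
∣⋃∣≤ {N} []   _                = ≤-reflexive (Subsetₚ.∣⊥∣≡0 N)
∣⋃∣≤ (p ∷ ps) (∣p∣≤c ∷ rest) = ≤-trans (∣p∪q∣≤∣p∣+∣q∣ p (⋃ ps)) (+-mono-≤ ∣p∣≤c (∣⋃∣≤ ps rest))

∈-⋃⁺ : ∀ {ps : List (Subset N)} {p e} → p ∈ ps → e Subset.∈ p → e Subset.∈ ⋃ ps
∈-⋃⁺ (here refl) e∈p = Subsetₚ.x∈p∪q⁺ (inj₁ e∈p)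
∈-⋃⁺ (there p∈)  e∈p = Subsetₚ.x∈p∪q⁺ (inj₂ (∈-⋃⁺ p∈ e∈p))

∈-⋃⁻ : ∀ (ps : List (Subset N)) {e} → e Subset.∈ ⋃ ps → ∃ λ p → p ∈ ps × e Subset.∈ p
∈-⋃⁻ []       e∈ = contradiction e∈ Subsetₚ.∉⊥
∈-⋃⁻ (p ∷ ps) e∈ with Subsetₚ.x∈p∪q⁻ p (⋃ ps) e∈
... | inj₁ e∈p = p , here refl , e∈p
... | inj₂ e∈⋃ with p′ , p′∈ , e∈p′ ← ∈-⋃⁻ ps e∈⋃ = p′ , there p′∈ , e∈p′

∣others∣≤ : ∀ {c} (P : Fin (suc s) → Subset N) → (∀ i → ∣ P i ∣ ≤ c) → ∀ i → ∣ others P i ∣ ≤ s * c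
∣others∣≤ {c = c} P small i = ≤-trans (∣⋃∣≤ _ (Allₚ.tabulate⁺ λ j → small (Fin.punchIn i j))) (≤-reflexive (cong (_* c) (length-tabulate (P ∘ Fin.punchIn i))))

∈-others⁺ : ∀ (P : Fin (suc s) → Subset N) {i j e} → i ≢ j → e Subset.∈ P j → e Subset.∈ others P i
∈-others⁺ P {e = e} i≢j e∈ = ∈-⋃⁺ (∈-tabulate⁺ (Fin.punchOut i≢j)) (subst (λ j → e Subset.∈ P j) (sym (Finₚ.punchIn-punchOut i≢j)) e∈)

∈-others⁻ : ∀ (P : Fin (suc s) → Subset N) {i e} → e Subset.∈ others P i → ∃ λ j → i ≢ j × e Subset.∈ P j
∈-others⁻ P {i} e∈ with p , p∈ , e∈p ← ∈-⋃⁻ _ e∈ with j , refl ← ∈-tabulate⁻ {f = P ∘ Fin.punchIn i} p∈ = Fin.punchIn i j , Finₚ.punchInᵢ≢i i j ∘ sym , e∈p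

replace : (Fin s → A) → Fin s → A → Fin s → A
replace P i T j with j Fin.≟ i
... | yes _ = T
... | no _  = P j

replace-elim : ∀ {P : Fin s → A} {i T} (C : Fin s → A → Set) → C i T → (∀ j → j ≢ i → C j (P j)) → ∀ j → C j (replace P i T j)
replace-elim {i = i} C CiT CjP j with j Fin.≟ i
... | yes refl = CiT
... | no j≢i   = CjP j j≢i

-- Completing the representatives to disjoint cores

module Completion {s N : ℕ} (𝒮 : Fin (suc s) → List (Subset N)) (small : ∀ i → All (λ T → ∣ T ∣ ≤ 2) (𝒮 i)) where

  -- The invariant covers both stages of an index: a core is extendable as well, being its own
  -- witness. Since all sets have at most two elements, the `s` others fit into the budget `s * 2`.
  record State (P : Fin (suc s) → Subset N) : Set where
    field
      extendable : ∀ i → Extendable (s * 2) (𝒮 i) (P i)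
      small₂     : ∀ i → ∣ P i ∣ ≤ 2
      disjoint   : PairwiseDisjoint P

  -- Forbid the union of the other representatives, which misses `P i`. Extendability then gives a
  -- core for `i` disjoint from all of them.
  step : ∀ P → State P → ∀ i → ∃ λ P′ → State P′ × P′ i ∈ 𝒮 i × (∀ j → P j ∈ 𝒮 j → P′ j ∈ 𝒮 j)
  step P st i = P′ , st′ , replace-elim (λ j p → j ≡ i → p ∈ 𝒮 j) (λ _ → T∈) (λ j j≢i j≡i → contradiction j≡i j≢i) i refl
              , replace-elim (λ j p → P j ∈ 𝒮 j → p ∈ 𝒮 j) (λ _ → T∈) (λ _ _ P∈ → P∈)
    where
    open State st
    found = find (extendable i (others P i) (∣others∣≤ P small₂ i) λ (e , e∈others , e∈Pi) →
      case ∈-others⁻ P e∈others of λ (j , i≢j , e∈Pj) → disjoint i j i≢j (e , e∈Pi , e∈Pj))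
    T = proj₁ found
    T∈ = proj₁ (proj₂ found)
    P′ = replace P i T
    T-apart : ∀ j → j ≢ i → ¬ Meets T (P j)
    T-apart j j≢i (e , e∈T , e∈Pj) = proj₂ (proj₂ found) (e , e∈T , ∈-others⁺ P (j≢i ∘ sym) e∈Pj)
    st′ : State P′
    st′ = record
      { extendable = replace-elim (λ j p → Extendable (s * 2) (𝒮 j) p) (λ X _ ¬meets → lose T∈ (¬Meets-sym ¬meets)) (λ j _ → extendable j)
      ; small₂     = replace-elim (λ _ p → ∣ p ∣ ≤ 2) (All.lookup (small i) T∈) (λ j _ → small₂ j)
      ; disjoint   = replace-elim (λ j p → ∀ l → j ≢ l → ¬ Meets p (P′ l))
          (replace-elim (λ l p → i ≢ l → ¬ Meets T p) (λ i≢i → contradiction refl i≢i) (λ l l≢i _ → T-apart l l≢i))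
          (λ j j≢i → replace-elim (λ l p → j ≢ l → ¬ Meets (P j) p) (λ _ → ¬Meets-sym (T-apart j j≢i)) (λ l _ → disjoint j l))
      }

  steps : ∀ js P → State P → ∃ λ P′ → State P′ × (∀ {j} → j ∈ js → P′ j ∈ 𝒮 j) × (∀ j → P j ∈ 𝒮 j → P′ j ∈ 𝒮 j)
  steps []       P st = P , st , (λ ()) , λ _ P∈ → P∈
  steps (i ∷ js) P st with P₁ , st₁ , P₁i∈ , keep₁ ← step P st i with P₂ , st₂ , P₂∈ , keep₂ ← steps js P₁ st₁ =
    P₂ , st₂ , (λ { (here refl) → keep₂ i P₁i∈ ; (there j∈) → P₂∈ j∈ }) , λ j → keep₂ j ∘ keep₁ j

  complete : ∀ P → State P → ∃ λ S → (∀ i → S i ∈ 𝒮 i) × (∀ i → ∣ S i ∣ ≤ 2) × PairwiseDisjoint S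
  complete P st with S , st′ , S∈ , _ ← steps (allFin (suc s)) P st = S , (λ i → S∈ (∈-allFin i)) , State.small₂ st′ , State.disjoint st′

-- From disjoint cores to a rainbow matching

module _ {n k R : ℕ} .{{_ : NonZero R}} {𝓕 : List (Tuple n k)} {S} (C : Core R 𝓕 S) where
  open Core C renaming (members to 𝓖)
  open ≤-Reasoning

  -- Spreadness of the link: apply `spread` to `U ∪ S` and cancel R^∣S∣.
  core-degree : ∀ U → ¬ Meets U S → deg 𝓖 (U ∪ S) * R ^ ∣ U ∣ ≤ length 𝓖
  core-degree U ¬meets = *-cancelʳ-≤ _ _ (R ^ ∣ S ∣) {{m^n≢0 R ∣ S ∣}} (begin
    deg 𝓖 (U ∪ S) * R ^ ∣ U ∣ * R ^ ∣ S ∣   ≡⟨ trans (*-assoc (deg 𝓖 (U ∪ S)) _ _) (cong (deg 𝓖 (U ∪ S) *_) (sym (^-distribˡ-+-* R ∣ U ∣ ∣ S ∣))) ⟩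
    deg 𝓖 (U ∪ S) * R ^ (∣ U ∣ + ∣ S ∣)
      ≤⟨ *-monoʳ-≤ (deg 𝓖 (U ∪ S)) (^-monoʳ-≤ R (disjoint⇒∣p∣+∣q∣≤∣p∪q∣ U S λ e∈U e∈S → ¬meets (_ , e∈U , e∈S))) ⟩
    deg 𝓖 (U ∪ S) * R ^ ∣ U ∪ S ∣           ≤⟨ spread (U ∪ S) ⟩
    length 𝓖 * R ^ ∣ S ∣                    ∎)

  module _ (X : Subset (k * n)) (¬X∩S : ¬ Meets X S) (few : 2 * ∣ X ∣ ≤ R) where

    avoids? : ∀ (F : Tuple n k) → Dec (¬ Meets X (toSet F))
    avoids? F = ¬? (meets? X (toSet F))

    avoiding : List (Tuple n k)
    avoiding = filter avoids? 𝓖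

    -- Each point of `X` lies in at most a fraction 1/R of the members, and 2 ∣X∣ ≤ R, so the points
    -- of `X` hit at most half of them.
    half-avoids : length 𝓖 ≤ 2 * length avoiding
    half-avoids = +-cancelʳ-≤ (length 𝓖) _ _ (begin
      length 𝓖 + length 𝓖                     ≡⟨ cong₂ _+_ split split ⟩
      length avoiding + hit + (length avoiding + hit)  ≡⟨ regroup (length avoiding) hit ⟩
      2 * length avoiding + 2 * hit           ≤⟨ +-monoʳ-≤ (2 * length avoiding) few-hit ⟩
      2 * length avoiding + length 𝓖          ∎)
      where
      hits = filter (λ F → ¬? (avoids? F)) 𝓖
      hit = length hits
      split : length 𝓖 ≡ length avoiding + hit
      split = length-partition avoids? 𝓖
      regroup : ∀ a b → a + b + (a + b) ≡ 2 * a + 2 * b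
      regroup = solve-∀

      through-X : hit ≤ ∑ (elements X) λ x → deg 𝓖 (⁅ x ⁆ ∪ S)
      through-X = begin
        hit
          ≡⟨ length≡∑1 hits ⟩
        ∑ hits (λ _ → 1)
          ≤⟨ ∑-mono hits (λ {F} F∈ → witness F F∈) ⟩
        ∑ hits (λ F → ∑ (elements X) λ x → ind (⁅ x ⁆ ∪ S ⊆? toSet F))
          ≤⟨ ∑-filter-≤ (λ F → ¬? (avoids? F)) 𝓖 (λ F → ∑ (elements X) λ x → ind (⁅ x ⁆ ∪ S ⊆? toSet F)) ⟩
        ∑ 𝓖 (λ F → ∑ (elements X) λ x → ind (⁅ x ⁆ ∪ S ⊆? toSet F))
          ≡⟨ ∑-swap 𝓖 (elements X) _ ⟩
        ∑ (elements X) (λ x → deg 𝓖 (⁅ x ⁆ ∪ S)) ∎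
        where
        witness : ∀ F → F ∈ hits → 1 ≤ ∑ (elements X) λ x → ind (⁅ x ⁆ ∪ S ⊆? toSet F)
        witness F F∈ = case ∈-filter⁻ (λ F → ¬? (avoids? F)) {xs = 𝓖} F∈ of λ where
          (F∈𝓖 , ¬avoids) → case decidable-stable (meets? X (toSet F)) ¬avoids of λ where
            (x , x∈X , x∈F) → ≤-trans (≤-reflexive (sym (ind-yes (⁅ x ⁆ ∪ S ⊆? toSet F) λ e∈ →
              case Subsetₚ.x∈p∪q⁻ ⁅ x ⁆ S e∈ of λ where
                (inj₁ e∈x) → ⁅x⁆⊆p x∈F e∈x
                (inj₂ e∈S) → contains F∈𝓖 e∈S))) (∑-∈ (λ x → ind (⁅ x ⁆ ∪ S ⊆? toSet F)) (∈-elements⁺ x∈X))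

      single : ∀ x → x Subset.∈ X → deg 𝓖 (⁅ x ⁆ ∪ S) * R ≤ length 𝓖
      single x x∈X = begin
        deg 𝓖 (⁅ x ⁆ ∪ S) * R              ≡⟨ cong (deg 𝓖 (⁅ x ⁆ ∪ S) *_) (sym (trans (cong (R ^_) (Subsetₚ.∣⁅x⁆∣≡1 x)) (*-identityʳ R))) ⟩
        deg 𝓖 (⁅ x ⁆ ∪ S) * R ^ ∣ ⁅ x ⁆ ∣
          ≤⟨ core-degree ⁅ x ⁆ (λ (e , e∈x , e∈S) → ¬X∩S (x , x∈X , subst (Subset._∈ S) (Subsetₚ.x∈⁅y⁆⇒x≡y x e∈x) e∈S)) ⟩
        length 𝓖                           ∎

      few-hit : 2 * hit ≤ length 𝓖
      few-hit = *-cancelˡ-≤ R (begin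
        R * (2 * hit)                                             ≡⟨ regroup₃ R hit ⟩
        2 * (hit * R)                                             ≤⟨ *-monoʳ-≤ 2 (*-monoˡ-≤ R through-X) ⟩
        2 * (∑ (elements X) (λ x → deg 𝓖 (⁅ x ⁆ ∪ S)) * R)        ≡⟨ cong (2 *_) (sym (∑-distribʳ-* (elements X) _ R)) ⟩
        2 * ∑ (elements X) (λ x → deg 𝓖 (⁅ x ⁆ ∪ S) * R)
          ≤⟨ *-monoʳ-≤ 2 (∑-≤-const (elements X) (length 𝓖) λ x∈ → single _ (∈-elements⁻ x∈)) ⟩
        2 * (length (elements X) * length 𝓖)
          ≡⟨ trans (sym (*-assoc 2 (length (elements X)) _)) (cong (λ u → 2 * u * length 𝓖) (length-elements X)) ⟩
        2 * ∣ X ∣ * length 𝓖                                      ≤⟨ *-monoˡ-≤ (length 𝓖) few ⟩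
        R * length 𝓖                                              ∎)
        where
        regroup₃ : ∀ a b → a * (2 * b) ≡ 2 * (b * a)
        regroup₃ = solve-∀

    links : Vec (Subset (k * n)) (length avoiding)
    links = Vec.tabulate λ x → toSet (List.lookup avoiding x) ─ S

    links-‼ : ∀ x → links ‼ x ≡ toSet (List.lookup avoiding x) ─ S
    links-‼ = lookup∘tabulate _

    ∣links∣≤k : ∀ x → ∣ links ‼ x ∣ ≤ k
    ∣links∣≤k x = ≤-trans (≤-reflexive (cong ∣_∣ (links-‼ x)))
      (≤-trans (Subsetₚ.∣p─q∣≤∣p∣ (toSet (List.lookup avoiding x)) S) (≤-reflexive (∣toSet∣ (List.lookup avoiding x))))

    avoiding-nonempty : NonZero (length avoiding)
    avoiding-nonempty = ≢-nonZero λ eq → contradiction (subst (λ u → length 𝓖 ≤ 2 * u) eq half-avoids) (<⇒≱ nonempty)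

    -- An empty `T` is trivial and a `T` meeting `S` has degree 0. Otherwise `core-degree` applies;
    -- restricting to the members that avoid `X` loses a factor 2, and as `T` is nonempty, lowering
    -- 8 m to 4 m regains it.
    links-spread : ∀ {m} → 8 * m ≤ R → ∀ T → degree links T * (4 * m) ^ ∣ T ∣ ≤ length avoiding
    links-spread {m} 8m≤R T = ≤-trans (*-monoˡ-≤ ((4 * m) ^ ∣ T ∣) (≤-reflexive degree≡)) (case (∣ T ∣ ≟ 0) ,′ meets? T S of λ where
        (yes ∣T∣≡0 , _) → ≤-trans (≤-reflexive (trans (cong (λ u → D * (4 * m) ^ u) ∣T∣≡0) (*-identityʳ D)))
                            (≤-trans (∑-≤-const avoiding 1 λ {F} _ → ind≤1 (T ⊆? toSet F ─ S)) (≤-reflexive (*-identityʳ _)))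
        (no _ , yes (e , e∈T , e∈S)) → ≤-trans (*-monoˡ-≤ ((4 * m) ^ ∣ T ∣) (≤-trans (∑-≤-const avoiding 0 λ {F} _ →
                            ≤-reflexive (ind-no (T ⊆? toSet F ─ S) λ T⊆ → x∈p─q⇒x∉q (toSet F) S (T⊆ e∈T) e∈S)) (≤-reflexive (*-zeroʳ (length avoiding))))) z≤n
        (no ∣T∣≢0 , no ¬T∩S) → *-cancelˡ-≤ 2 (begin
          2 * (D * (4 * m) ^ ∣ T ∣)              ≡⟨ regroup D _ ⟩
          D * (2 * (4 * m) ^ ∣ T ∣)              ≤⟨ *-monoʳ-≤ D (double ∣ T ∣ (n≢0⇒n>0 ∣T∣≢0)) ⟩
          D * R ^ ∣ T ∣                          ≤⟨ *-monoˡ-≤ (R ^ ∣ T ∣) D≤ ⟩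
          deg 𝓖 (T ∪ S) * R ^ ∣ T ∣              ≤⟨ core-degree T ¬T∩S ⟩
          length 𝓖                               ≤⟨ half-avoids ⟩
          2 * length avoiding                    ∎))
      where
      D = ∑ avoiding λ F → ind (T ⊆? toSet F ─ S)
      degree≡ : degree links T ≡ D
      degree≡ = trans (∑-cong (allFin (length avoiding)) λ x → cong (λ u → ind (T ⊆? u)) (links-‼ x)) (∑-lookup avoiding _)
      regroup : ∀ a b → 2 * (a * b) ≡ a * (2 * b)
      regroup = solve-∀
      D≤ : D ≤ deg 𝓖 (T ∪ S)
      D≤ = ≤-trans (∑-mono avoiding λ {F} F∈ → ind-mono (T ⊆? toSet F ─ S) (T ∪ S ⊆? toSet F) λ T⊆ e∈ →
             case Subsetₚ.x∈p∪q⁻ T S e∈ of λ where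
               (inj₁ e∈T) → Subsetₚ.p─q⊆p (toSet F) S (T⊆ e∈T)
               (inj₂ e∈S) → contains (proj₁ (∈-filter⁻ avoids? {xs = 𝓖} F∈)) e∈S)
           (∑-filter-≤ avoids? 𝓖 λ F → ind (T ∪ S ⊆? toSet F))
      double : ∀ t → 0 < t → 2 * (4 * m) ^ t ≤ R ^ t
      double (suc t) _ = begin
        2 * (4 * m * (4 * m) ^ t)     ≡⟨ regroup′ m ((4 * m) ^ t) ⟩
        8 * m * (4 * m) ^ t           ≤⟨ *-mono-≤ 8m≤R (^-monoˡ-≤ t (≤-trans (*-monoˡ-≤ m (m≤m+n 4 4)) 8m≤R)) ⟩
        R * R ^ t                     ∎
        where
        regroup′ : ∀ a b → 2 * (4 * a * b) ≡ 8 * a * b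
        regroup′ = solve-∀

-- Each chosen tuple avoids the cores of the other families. A common element of two of them is
-- therefore outside both cores, so it lies in both links and would have a colour owned by both
-- families.
cores⇒rainbow-matching : ∀ {n k s R β} → (𝓕 : Fin (suc s) → List (Tuple n k)) (S : Fin (suc s) → Subset (k * n)) →
  (∀ i → Core R (𝓕 i) (S i)) → (∀ i → ∣ S i ∣ ≤ 2) → PairwiseDisjoint S →
  suc s * k < 2 ^ suc β → 8 * (suc s * suc β) ≤ R →
  ∃ λ (F : Fin (suc s) → Tuple n k) → (∀ i → F i ∈ 𝓕 i) × (∀ i j → i ≢ j → Disjoint (F i) (F j))
cores⇒rainbow-matching {n} {k} {s} {R} {β} 𝓕 S C small disjoint sk<2^β 8m≤R = F , F∈𝓕 , F-disjoint
  where
  instance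
    R≢0 : NonZero R
    R≢0 = >-nonZero (≤-trans z<s 8m≤R)

  X : Fin (suc s) → Subset (k * n)
  X = others S

  X-apart : ∀ i → ¬ Meets (X i) (S i)
  X-apart i (e , e∈X , e∈Si) with j , i≢j , e∈Sj ← ∈-others⁻ S e∈X = disjoint i j i≢j (e , e∈Si , e∈Sj)

  few : ∀ i → 2 * ∣ X i ∣ ≤ R
  few i = begin
    2 * ∣ X i ∣              ≤⟨ *-monoʳ-≤ 2 (∣others∣≤ S small i) ⟩
    2 * (s * 2)              ≡⟨ regroup s ⟩
    4 * s                    ≤⟨ *-mono-≤ (m≤m+n 4 4) (≤-trans (n≤1+n s) (m≤m*n (suc s) (suc β))) ⟩
    8 * (suc s * suc β)      ≤⟨ 8m≤R ⟩
    R                        ∎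
    where
    open ≤-Reasoning
    regroup : ∀ a → 2 * (a * 2) ≡ 4 * a
    regroup = solve-∀

  colouring = spread⇒rainbow-colouring {β = suc β}
    (λ i → length (avoiding (C i) (X i) (X-apart i) (few i)))
    (λ i → links (C i) (X i) (X-apart i) (few i))
    (λ i → avoiding-nonempty (C i) (X i) (X-apart i) (few i))
    (λ i → ∣links∣≤k (C i) (X i) (X-apart i) (few i))
    (λ i → links-spread (C i) (X i) (X-apart i) (few i) {suc s * suc β} 8m≤R)
    sk<2^β
  χ = proj₁ colouring

  F : Fin (suc s) → Tuple n k
  F i = List.lookup (avoiding (C i) (X i) (X-apart i) (few i)) (proj₁ (proj₂ colouring i))

  F∈ : ∀ i → F i ∈ Core.members (C i) × ¬ Meets (X i) (toSet (F i))
  F∈ i = ∈-filter⁻ (avoids? (C i) (X i) (X-apart i) (few i)) {xs = Core.members (C i)} (∈-lookup {xs = avoiding (C i) (X i) (X-apart i) (few i)} _)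

  F∈𝓕 : ∀ i → F i ∈ 𝓕 i
  F∈𝓕 i = Core.sub (C i) (proj₁ (F∈ i))

  F∩S : ∀ i j → i ≢ j → ∀ {e} → e Subset.∈ toSet (F i) → e Subset.∉ S j
  F∩S i j i≢j e∈F e∈S = proj₂ (F∈ i) (_ , ∈-others⁺ S i≢j e∈S , e∈F)

  colour : ∀ i {e} → e Subset.∈ toSet (F i) → e Subset.∉ S i → ∃ λ t → lookup χ e ≡ Fin.combine i t
  colour i {e} e∈F e∉S = proj₂ (proj₂ colouring i)
    (subst (e Subset.∈_) (sym (links-‼ (C i) (X i) (X-apart i) (few i) _)) (Subsetₚ.x∈p∧x∉q⇒x∈p─q e∈F e∉S))

  F-disjoint : ∀ i j → i ≢ j → Disjoint (F i) (F j)
  F-disjoint i j i≢j = toSet-disjoint (F i) (F j) λ e∈Fi e∈Fj →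
    let t , χe≡  = colour i e∈Fi (F∩S j i (i≢j ∘ sym) e∈Fj)
        u , χe≡′ = colour j e∈Fj (F∩S i j i≢j e∈Fi)
    in i≢j (Finₚ.combine-injectiveˡ i t j u (trans (sym χe≡) χe≡′))

-- Numerical hypotheses and conclusion

∃⌊log₂⌋ : ∀ n .{{_ : NonZero n}} → ∃ λ l → 2 ^ l ≤ n × n < 2 ^ suc l
∃⌊log₂⌋ 1             = 0 , ≤-refl , ≤-refl
∃⌊log₂⌋ (suc n@(suc _)) with l , 2^l≤n , n<2^1+l ← ∃⌊log₂⌋ n with suc n <? 2 ^ suc l
... | yes 1+n<2^1+l = l , m≤n⇒m≤1+n 2^l≤n , 1+n<2^1+l
... | no  1+n≮2^1+l = suc l , ≮⇒≥ 1+n≮2^1+l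
                    , <-≤-trans (s≤s n<2^1+l) (≤-trans (+-monoˡ-≤ (2 ^ suc l) (m^n>0 2 (suc l))) (≤-reflexive (cong (2 ^ suc l +_) (sym (+-identityʳ _)))))

^-cancelʳ-< : ∀ m .{{_ : NonZero m}} {a b} → m ^ a < m ^ b → a < b
^-cancelʳ-< m {a} {b} m^a<m^b = ≰⇒> λ b≤a → <⇒≱ m^a<m^b (^-monoʳ-≤ m b≤a)

-- The hypotheses, freed of the rational approximation of the logarithm: 2 ^ l ≤ s k makes l a lower bound for it.
module _ {n k s l : ℕ} (2^l≤sk : 2 ^ l ≤ s * k) where

  largeN⇒R≤n : LargeN n k s → 32 * s * l ≤ n
  largeN⇒R≤n large = <⇒≤ (^-cancelʳ-< 2 (≤-<-trans (begin
    2 ^ (32 * s * l)     ≡⟨ cong (2 ^_) (*-comm (32 * s) l) ⟩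
    2 ^ (l * (32 * s))   ≡⟨ sym (^-*-assoc 2 l (32 * s)) ⟩
    (2 ^ l) ^ (32 * s)   ≤⟨ ^-monoˡ-≤ (32 * s) 2^l≤sk ⟩
    (s * k) ^ (32 * s)   ∎) large))
    where open ≤-Reasoning

  bound-exceeded : ∀ {i m} → BoundExceeded n k s i m →
    i * n ^ (k + 1) + 4 * (s ∸ 1) ^ 2 * n ^ k + (32 * s * l) ^ 3 * n ^ (k ∸ 1) < m * n ^ 2
  bound-exceeded {i} {m} (a , b , 1≤b , sk^b<2^a , exceeded) = *-cancelʳ-< _ _ _ (≤-<-trans (begin
    -- The constant 2^15 is 32^3, so the last term of the bound dominates R^3 with R = 32 s l.
    (E + (32 * s * l) ^ 3 * M) * b ^ 3                             ≡⟨ expand 32 E s l M b ⟩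
    E * b ^ 3 + 2 ^ 15 * s ^ 3 * M * (l * b) ^ 3        ≤⟨ +-monoʳ-≤ (E * b ^ 3) (*-monoʳ-≤ (2 ^ 15 * s ^ 3 * M) (^-monoˡ-≤ 3 lb≤a)) ⟩
    E * b ^ 3 + 2 ^ 15 * s ^ 3 * M * a ^ 3              ∎) exceeded)
    where
    open ≤-Reasoning
    E = i * n ^ (k + 1) + 4 * (s ∸ 1) ^ 2 * n ^ k
    M = n ^ (k ∸ 1)
    lb≤a : l * b ≤ a
    lb≤a = <⇒≤ (^-cancelʳ-< 2 (≤-<-trans (≤-trans (≤-reflexive (sym (^-*-assoc 2 l b))) (^-monoˡ-≤ b 2^l≤sk)) sk^b<2^a))
    expand : ∀ c E s l M b → (E + c * s * l * (c * s * l * (c * s * l * 1)) * M) * (b * (b * (b * 1)))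
                           ≡ E * (b * (b * (b * 1))) + c * (c * (c * 1)) * (s * (s * (s * 1))) * M * (l * b * (l * b * (l * b * 1)))
    expand = solve-∀

-- Here `s` is one less than the number of families, so q = 2 s and the q² pairs account exactly for
-- the second term of the bound; the third is the error of the approximation. Only heavy points can
-- supply the rest. A further factor n matches the n^3 in `blocked-bound`.
many-heavy : ∀ {n k′ s R i} .{{_ : NonZero n}} {𝓕 : List (Tuple n (suc k′))} → Unique 𝓕 → (S : Approximation R 𝓕) →
  i * n ^ (suc k′ + 1) + 4 * s ^ 2 * n ^ suc k′ + R ^ 3 * n ^ k′ < length 𝓕 * n ^ 2 →
  let open Approximation S in ∃ (Blocks (s * 2) cores Subset.⊥) → i < length (heavy (s * 2) cores)
many-heavy {n} {k′} {s} {R} {i} {𝓕} uniq S exceeded blocked =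
  *-cancelʳ-< _ _ _ (+-cancelʳ-< (s * 2 * (s * 2) * n ^ (1 + K)) _ _ (+-cancelʳ-< (R ^ 3 * n ^ K) _ _ (begin-strict
    i * n ^ (2 + K) + s * 2 * (s * 2) * n ^ (1 + K) + R ^ 3 * n ^ K
      ≡⟨ regroup i s n (n ^ k′) (R ^ 3) ⟩
    (i * (n ^ K * n) + 4 * s ^ 2 * n ^ K + R ^ 3 * n ^ k′) * n
      ≡⟨ cong (λ u → (i * u + 4 * s ^ 2 * n ^ K + R ^ 3 * n ^ k′) * n) (trans (*-comm (n ^ K) n) (cong (n ^_) (sym (+-comm K 1)))) ⟩
    (i * n ^ (K + 1) + 4 * s ^ 2 * n ^ K + R ^ 3 * n ^ k′) * n
      <⟨ *-monoˡ-< n exceeded ⟩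
    length 𝓕 * n ^ 2 * n
      ≡⟨ regroup′ (length 𝓕) n ⟩
    length 𝓕 * n ^ 3
      ≤⟨ blocked-bound uniq S blocked ⟩
    length (heavy (s * 2) cores) * n ^ (2 + K) + s * 2 * (s * 2) * n ^ (1 + K) + R ^ 3 * n ^ K ∎)))
  where
  open ≤-Reasoning
  open Approximation S
  K = suc k′
  regroup : ∀ i s n M c → i * (n * (n * (n * M))) + s * 2 * (s * 2) * (n * (n * M)) + c * (n * M)
                        ≡ (i * (n * M * n) + 4 * (s * (s * 1)) * (n * M) + c * M) * n
  regroup = solve-∀
  regroup′ : ∀ a n → a * (n * (n * 1)) * n ≡ a * (n * (n * (n * 1)))
  regroup′ = solve-∀

rainbow-matching : ∀ {n k′ s l} .{{_ : NonZero n}} (let K = suc k′; R = 32 * suc s * suc l) (𝓕 : Fin (suc s) → Family n K) → R ≤ n →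
  suc s * K < 2 ^ suc (suc l) →
  (∀ i → toℕ i * n ^ (K + 1) + 4 * s ^ 2 * n ^ K + R ^ 3 * n ^ k′ < card (𝓕 i) * n ^ 2) →
  ∃ λ (F : Fin (suc s) → Tuple n K) → (∀ i → F i ∈ members (𝓕 i)) × (∀ i j → i ≢ j → Disjoint (F i) (F j))
rainbow-matching {n} {k′} {s} {l} 𝓕 R≤n sk<2^2+l exceeded =
  cores⇒rainbow-matching {β = suc l} (members ∘ 𝓕) (proj₁ completed) (λ i → All.lookup (core (𝓐 i)) (proj₁ (proj₂ completed) i))
    (proj₁ (proj₂ (proj₂ completed))) (proj₂ (proj₂ (proj₂ completed))) sk<2^2+l 8m≤R
  where
  open Approximation
  K = suc k′
  R = 32 * suc s * suc l

  𝓐 : ∀ i → Approximation R (members (𝓕 i))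
  𝓐 i = approximate R R≤n (card (𝓕 i)) (members (𝓕 i)) (unique (𝓕 i)) ≤-refl

  𝒮 : Fin (suc s) → List (Subset (K * n))
  𝒮 i = cores (𝓐 i)

  options : ∀ i → Extendable (s * 2) (𝒮 i) Subset.⊥ ⊎
    ∃ λ L → Unique L × toℕ i < length L × (∀ {x} → x ∈ L → Extendable (s * 2) (𝒮 i) ⁅ x ⁆)
  options i = case blocked? (s * 2) (𝒮 i) Subset.⊥ of λ where
    (no ¬blocked) → inj₁ (¬blocked⇒extendable (s * 2) (𝒮 i) ¬blocked)
    (yes blocked) → inj₂ (heavy (s * 2) (𝒮 i) , heavy-unique (s * 2) (𝒮 i)
      , many-heavy {s = s} (unique (𝓕 i)) (𝓐 i) (exceeded i) blocked
      , λ {_} → heavy⇒extendable (s * 2) (𝒮 i))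

  completed : ∃ λ S → (∀ i → S i ∈ 𝒮 i) × (∀ i → ∣ S i ∣ ≤ 2) × PairwiseDisjoint S
  completed with P , extendable , P≤1 , disjoint ← disjoint-representatives (λ i → Extendable (s * 2) (𝒮 i)) options =
    Completion.complete 𝒮 (λ i → small (𝓐 i)) P (record
      { extendable = extendable ; small₂ = λ i → ≤-trans (P≤1 i) (s≤s z≤n) ; disjoint = disjoint })

  -- With ℓ = `suc l` there are ℓ + 1 colours for each family, and the claim reduces to ℓ + 1 ≤ 4 ℓ,
  -- valid because ℓ ≥ 1.
  8m≤R : 8 * (suc s * suc (suc l)) ≤ R
  8m≤R = begin
    8 * (suc s * suc (suc l))           ≤⟨ *-monoʳ-≤ 8 (*-monoʳ-≤ (suc s) (+-monoˡ-≤ (suc l) (s≤s (z≤n {3 * l + 2})))) ⟩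
    8 * (suc s * (1 + (3 * l + 2) + suc l)) ≡⟨ regroup s l ⟩
    32 * suc s * suc l ∎
    where
    open ≤-Reasoning
    regroup : ∀ s l → 8 * (suc s * (1 + (3 * l + 2) + suc l)) ≡ 32 * suc s * suc l
    regroup = solve-∀

nonempty⇒∃∈ : ∀ (xs : List A) → 0 < length xs → ∃ λ x → x ∈ xs
nonempty⇒∃∈ (x ∷ _) _ = x , here refl

exceeded⇒nonempty : ∀ {n k s i m} → BoundExceeded n k s i m → 0 < m
exceeded⇒nonempty {m = zero}  (_ , _ , _ , _ , bound) = contradiction bound n≮0
exceeded⇒nonempty {m = suc _} _                       = z<s

-- Treated apart because s k may be 1 here, which would make ℓ and R vanish. No disjointness is
-- asked, so a nonempty family is enough.
single-family : ∀ n k → Satisfying n k 1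
single-family n k 𝓕 exceeded = (λ _ → proj₁ found) , (λ { zero → proj₂ found }) , λ { zero zero i≢j → contradiction refl i≢j }
  where
  found = nonempty⇒∃∈ (members (𝓕 zero)) (exceeded⇒nonempty {n} {k} {1} {0} (exceeded zero))

theorem5 : (n k s : ℕ) → 1 ≤ n → 1 ≤ k → 1 ≤ s →
    LargeN n k s → Satisfying n k s
theorem5 n k 1 1≤n 1≤k 1≤s large = single-family n k
theorem5 n@(suc _) k@(suc _) s@(suc s′@(suc _)) 1≤n 1≤k 1≤s large 𝓕 exceeded = case ∃⌊log₂⌋ (s * k) of λ where
  -- Now s ≥ 2, hence s k ≥ 2 and the integer logarithm is positive.
  (zero  , _      , sk<2)     → contradiction sk<2 (≤⇒≯ (≤-trans (s≤s (s≤s z≤n)) (m≤m*n s k)))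
  (suc l , 2^l≤sk , sk<2^2+l) → rainbow-matching {l = l} 𝓕 (largeN⇒R≤n {n} {k} {s} {suc l} 2^l≤sk large) sk<2^2+l
    λ i → bound-exceeded {n} {k} {s} {suc l} 2^l≤sk {toℕ i} {card (𝓕 i)} (exceeded i)
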